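{- Let $S = \operatorname{stack}(P, Q) \in \mathrm{SYT}(2r \times c)$ where $P, Q \in \mathrm{SYT}(r \times c)$ and $n \coloneqq rc$. Let $\rho_i \coloneqq \operatorname{prom}_i(S) \in \mathfrak{S}_{2n}$ for $1 \leq i \leq 2r-1$. Then \begin{equation*} \mathcal{V}(\mathcal{P}^{\mathrm{NE}}(\rho_r), \nearrow) = (\mathcal{E}(P), Q). \end{equation*} Furthermore, for $0 \leq k \leq r-1$, \begin{equation*} \begin{split} \mathcal{P}^{\mathrm{NE}}(\rho_{r+k}) &= \mathcal{S}^k(\mathcal{P}^{\mathrm{NE}}(\rho_r), \nearrow) \\ \mathcal{P}^{\mathrm{NE}}(\rho_{r-k}) &= \mathcal{S}^k(\mathcal{P}^{\mathrm{NE}}(\rho_r), \swarrow). \end{split} \end{equation*} More precisely, the skeleton of the $j$-th shadow line of the skeleton $\mathcal{S}^k(\mathcal{P}^{\mathrm{NE}}(\rho_r), \nearrow)$ (or $\mathcal{S}^k(\mathcal{P}^{\mathrm{NE}}(\rho_r), \swarrow)$) is the $j$-th shadow line of the next skeleton $\mathcal{S}^{k+1}(\mathcal{P}^{\mathrm{NE}}(\rho_r), \nearrow)$ (or $\mathcal{S}^{k+1}(\mathcal{P}^{\mathrm{NE}}(\rho_r), \swarrow)$).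
   Context: $\mathrm{SYT}(r \times c)$ is the set of standard Young tableaux of rectangular shape with $r$ rows and $c$ columns. For $P, Q \in \mathrm{SYT}(r\times c)$ with $n = rc$, $\operatorname{stack}(P,Q) \in \mathrm{SYT}(2r \times c)$ is obtained by adding $n$ to every entry of $Q$ and placing the result below $P$. $\mathcal{E}$ denotes Schützenberger evacuation. Gromotion of a tableau deletes its smallest entry, rectifies by jeu de taquin slides until the empty cell reaches an outer corner, and fills that corner with (largest entry)$+1$, without decrementing entries. For $T \in \mathrm{SYT}(R \times c)$ with $N = Rc$, the $i$-th promotion permutation $\operatorname{prom}_i(T) \in \mathfrak{S}_N$ ($1 \le i \le R-1$) lists the entries that slide into row $i$ when computing the successive gromotions $g(T), g^2(T), \ldots, g^N(T)$, taken modulo $N$ with residues in $\{1,\ldots,N\}$. A permutation $\rho \in \mathfrak{S}_{2n}$ is identified with the $2n\times 2n$ matrix $M(\rho)$ with $M_{i,\rho(i)} = 1$ and $0$ elsewhere; $M(\rho)^{\mathrm{NE}}$ is its northeast $n\times n$ block (rows $1,\ldots,n$, columns $n+1,\ldots,2n$). For an $n\times n$ $0/1$ matrix $M$ with at most one nonzero entry per row and column, $\mathcal{P}(M) \coloneqq \{(y, n+1-x) \mid M_{xy} = 1\} \subseteq [n]\times[n]$, and $\mathcal{P}^{\mathrm{NE}}(\rho) \coloneqq \mathcal{P}(M(\rho)^{\mathrm{NE}})$. On $\mathbb{Z}\times\mathbb{Z}$ define $(a,b)\nearrow(x,y)$ iff $a\le x$ and $b\le y$, and $(a,b)\swarrow(x,y)$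 iff $a\ge x$ and $b\ge y$. Let $\mathcal{P}$ be a finite set of points with pairwise distinct $x$-coordinates and pairwise distinct $y$-coordinates. For a direction $\nearrow$ (and verbatim for $\swarrow$): the first shadow line $\mathcal{L}_1(\mathcal{P},\nearrow)$ is the set of minimal elements of $\mathcal{P}$ under $\nearrow$, and the $j$-th shadow line $\mathcal{L}_j(\mathcal{P},\nearrow)$ is the set of minimal elements of $\mathcal{P}$ minus the earlier shadow lines. The skeleton $\mathcal{S}(\mathcal{L},\nearrow)$ of a shadow line $\mathcal{L}$ is the set of minimal elements under $\nearrow$ of the region of points lying in the shadow (points weakly north-east, i.e. $\nearrow$-above) of at least two points of $\mathcal{L}$; the skeleton of $\mathcal{P}$ is $\mathcal{S}(\mathcal{P},\nearrow) = \bigcup_j \mathcal{S}(\mathcal{L}_j(\mathcal{P},\nearrow),\nearrow)$, and $\mathcal{S}^0(\mathcal{P},\nearrow)=\mathcal{P}$, $\mathcal{S}^{i+1}(\mathcal{P},\nearrow)=\mathcal{S}(\mathcal{S}^i(\mathcal{P},\nearrow),\nearrow)$. Viennot's construction $\mathcal{V}(\mathcal{P},\nearrow) = (A,B)$: draw the shadow lines of all skeleta $\mathcal{S}^i(\mathcal{P},\nearrow)$, labeling those coming from the $i$-th skeleton with $i+1$; reading labels along the extreme right edge bottom-to-top gives a lattice word $w_A$, and along the extreme top edge left-to-right gives a lattice word $w_B$; $A$, $B$ are the standard tableaux whose lattice words are these (entry $i$ lies in row $w_i$). -}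

module Defs where

open import Data.Nat using (ℕ; zero; suc; _+_; _*_; _∸_; _≡ᵇ_; _<ᵇ_; _⊔_; _%_)
import Data.Nat as ℕ
open import Data.Integer as ℤ using (ℤ; +_)
open import Data.Bool using (Bool; true; false; if_then_else_; _∧_)
open import Data.Maybe using (Maybe; just; nothing; fromMaybe)
import Data.Maybe as Maybe
open import Data.List using (List; []; _∷_; map; foldr; concatMap; upTo)
open import Data.List.Membership.Propositional using (_∈_)
open import Data.List.Relation.Unary.Linked using (Linked)
open import Data.Product using (Σ; Σ-syntax; _×_; _,_; proj₁; proj₂)
open import Data.Empty using (⊥)
open import Relation.Nullary using (¬_)
open import Relation.Binary.PropositionalEquality using (_≡_; _≢_)

-- Tableaux.
-- A (partial) filling of the quadrant: rows and columns are 0-indexed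
-- internally; `nothing` means "no cell / empty cell".

Filling : Set
Filling = ℕ → ℕ → Maybe ℕ

emptyFilling : Filling
emptyFilling _ _ = nothing

update : Filling → ℕ → ℕ → Maybe ℕ → Filling
update T i j v a b = if (a ≡ᵇ i) ∧ (b ≡ᵇ j) then v else T a b

record IsSYT (R c : ℕ) (T : Filling) : Set where
  field
    shape     : ∀ i j → (T i j ≡ nothing → ¬ (i ℕ.< R × j ℕ.< c))
                      × (¬ (i ℕ.< R × j ℕ.< c) → T i j ≡ nothing)
    range     : ∀ i j v → T i j ≡ just v → 1 ℕ.≤ v × v ℕ.≤ R * c
    injective : ∀ i j i' j' v → T i j ≡ just v → T i' j' ≡ just v → i ≡ i' × j ≡ j'
    surjective : ∀ v → 1 ℕ.≤ v → v ℕ.≤ R * c → Σ ℕ λ i → Σ ℕ λ j → T i j ≡ just v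
    rowInc    : ∀ i j u v → T i j ≡ just u → T i (suc j) ≡ just v → u ℕ.< v
    colInc    : ∀ i j u v → T i j ≡ just u → T (suc i) j ≡ just v → u ℕ.< v

stack : (r n : ℕ) → Filling → Filling → Filling
stack r n P Q i j = if i <ᵇ r then P i j else Maybe.map (λ v → n + v) (Q (i ∸ r) j)

cells : ℕ → ℕ → List (ℕ × ℕ)
cells R c = concatMap (λ i → map (λ j → (i , j)) (upTo c)) (upTo R)

maxEntry : ℕ → ℕ → Filling → ℕ
maxEntry R c T = foldr (λ ij m → fromMaybe 0 (T (proj₁ ij) (proj₂ ij)) ⊔ m) 0 (cells R c)

isJust≡ : Maybe ℕ → ℕ → Bool
isJust≡ nothing  v = false
isJust≡ (just u) v = u ≡ᵇ v

-- Jeu de taquin slide of the empty cell (marked `nothing`) at (i , j),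
-- with fuel.  Returns the new filling (hole still marked `nothing`),
-- the final position of the hole, and the list of "upward" moves
-- (a , v): entry v slid from row a+1 up into row a (0-indexed rows).

SlideResult : Set
SlideResult = Filling × (ℕ × ℕ) × List (ℕ × ℕ)

slide : ℕ → Filling → ℕ → ℕ → SlideResult
slide zero    T i j = T , (i , j) , []
slide (suc f) T i j = step (T i (suc j)) (T (suc i) j)
  where
  goRight : ℕ → SlideResult
  goRight a = slide f (update (update T i j (just a)) i (suc j) nothing) i (suc j)
  goDown : ℕ → SlideResult
  goDown b with slide f (update (update T i j (just b)) (suc i) j nothing) (suc i) j
  ... | T' , h , ms = T' , h , ((i , b) ∷ ms)
  step : Maybe ℕ → Maybe ℕ → SlideResult
  step nothing  nothing  = T , (i , j) , []
  step (just a) nothing  = goRight a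
  step nothing  (just b) = goDown b
  step (just a) (just b) = if a <ᵇ b then goRight a else goDown b

-- Delete the smallest entry (at the corner (0,0) of a standard tableau)
-- and rectify by jeu de taquin (fuel R + c suffices for an R × c shape).
deleteAndSlide : ℕ → ℕ → Filling → SlideResult
deleteAndSlide R c T = slide (R + c) (update T 0 0 nothing) 0 0

gromWithMoves : ℕ → ℕ → Filling → Filling × List (ℕ × ℕ)
gromWithMoves R c T with deleteAndSlide R c T
... | T' , (i , j) , ms = update T' i j (just (suc (maxEntry R c T))) , ms

grom : ℕ → ℕ → Filling → Filling
grom R c T = proj₁ (gromWithMoves R c T)

gromIter : ℕ → ℕ → Filling → ℕ → Filling
gromIter R c T zero    = T
gromIter R c T (suc m) = grom R c (gromIter R c T m)

lookupRow : ℕ → List (ℕ × ℕ) → ℕ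
lookupRow a []             = 0
lookupRow a ((b , v) ∷ ms) = if a ≡ᵇ b then v else lookupRow a ms

residue : ℕ → ℕ → ℕ
residue zero    v = v
residue (suc N) v with v % suc N
... | zero  = suc N
... | suc m = suc m

-- prom_i(T) for T in SYT(R × c), in one-line notation, as a function
-- on {1, …, R c}: the value at m is (mod N) the entry that slides into
-- row i (1-indexed) while computing the m-th gromotion g^m(T) from g^(m-1)(T).
prom : (R c i : ℕ) → Filling → ℕ → ℕ
prom R c i T m =
  residue (R * c) (lookupRow (i ∸ 1) (proj₂ (gromWithMoves R c (gromIter R c T (m ∸ 1)))))

evacLoop : ℕ → ℕ → ℕ → ℕ → Filling → Filling → Filling
evacLoop R c zero    k cur res = res
evacLoop R c (suc s) k cur res with deleteAndSlide R c cur
... | cur' , (i , j) , _ = evacLoop R c s (k ∸ 1) cur' (update res i j (just k))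

evac : ℕ → ℕ → Filling → Filling
evac R c T = evacLoop R c (R * c) (R * c) T emptyFilling

rowOf : ℕ → ℕ → Filling → ℕ → ℕ
rowOf R c T v = foldr (λ ij r → if isJust≡ (T (proj₁ ij) (proj₂ ij)) v then suc (proj₁ ij) else r)
                      0 (cells R c)

latticeWord : ℕ → ℕ → Filling → List ℕ
latticeWord R c T = map (rowOf R c T) (map suc (upTo (R * c)))

Pt : Set
Pt = ℤ × ℤ

PSet : Set₁
PSet = Pt → Set

_≐_ : PSet → PSet → Set
A ≐ B = ∀ p → (A p → B p) × (B p → A p)

-- P^NE(ρ) for ρ : [2n] → [2n] (given as a function ℕ → ℕ):
-- M(ρ)^NE has a 1 at (x , y) (x, y ∈ [n]) iff ρ(x) = n + y,
-- and P(M) = {(y , n+1-x) | M_xy = 1}.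
PNE : ℕ → (ℕ → ℕ) → PSet
PNE n ρ p = Σ ℕ λ x → Σ ℕ λ y →
  (1 ℕ.≤ x) × (x ℕ.≤ n) × (1 ℕ.≤ y) × (y ℕ.≤ n) × (ρ x ≡ n + y)
  × (p ≡ (+ y , + (suc n ∸ x)))

data Dir : Set where
  ↗ ↙ : Dir

Rel : Dir → Pt → Pt → Set
Rel ↗ (a , b) (x , y) = a ℤ.≤ x × b ℤ.≤ y
Rel ↙ (a , b) (x , y) = x ℤ.≤ a × y ℤ.≤ b

Min : Dir → PSet → PSet
Min d A p = A p × (∀ q → A q → Rel d q p → q ≡ p)

Rest : Dir → PSet → ℕ → PSet
Rest d A zero    = A
Rest d A (suc j) p = Rest d A j p × ¬ Min d (Rest d A j) p

ShadowLine : Dir → PSet → ℕ → PSet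
ShadowLine d A zero    _ = ⊥
ShadowLine d A (suc j) = Min d (Rest d A j)

Region : Dir → PSet → PSet
Region d L q = Σ Pt λ p₁ → Σ Pt λ p₂ →
  L p₁ × L p₂ × p₁ ≢ p₂ × Rel d p₁ q × Rel d p₂ q

SkeletonLine : Dir → PSet → PSet
SkeletonLine d L = Min d (Region d L)

Skeleton : Dir → PSet → PSet
Skeleton d A q = Σ ℕ λ j → (1 ℕ.≤ j) × SkeletonLine d (ShadowLine d A j) q

SkeletonIter : Dir → PSet → ℕ → PSet
SkeletonIter d A zero    = A
SkeletonIter d A (suc k) = Skeleton d (SkeletonIter d A k)

-- Viennot's construction for ↗.
-- The drawn lines are the shadow lines L_j(S^i(X, ↗), ↗) (j ≥ 1), labelled i+1.
-- A ↗-shadow line meets the extreme right edge at the height of its lowest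
-- point and the extreme top edge at the abscissa of its leftmost point.

DrawnLine : PSet → ℕ → ℕ → PSet
DrawnLine X i j = ShadowLine ↗ (SkeletonIter ↗ X i) j

RightEnd : PSet → ℕ → ℕ → ℤ → Set
RightEnd X i j y = (1 ℕ.≤ j) × (Σ ℤ λ x → DrawnLine X i j (x , y))
                   × (∀ p → DrawnLine X i j p → y ℤ.≤ proj₂ p)

TopEnd : PSet → ℕ → ℕ → ℤ → Set
TopEnd X i j x = (1 ℕ.≤ j) × (Σ ℤ λ y → DrawnLine X i j (x , y))
                 × (∀ p → DrawnLine X i j p → x ℤ.≤ proj₁ p)

-- w is the word of labels read along an edge, in increasing order of the
-- coordinate where the lines (i , j) meet that edge.
ReadsAs : (ℕ → ℕ → ℤ → Set) → List ℕ → Set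
ReadsAs E w = Σ (List (ℤ × ℕ × ℕ)) λ es →
    (∀ z i j → ((z , i , j) ∈ es → E i j z) × (E i j z → (z , i , j) ∈ es))
  × Linked (λ e e' → proj₁ e ℤ.< proj₁ e') es
  × (w ≡ map (λ e → suc (proj₁ (proj₂ e))) es)

-- 𝒱(X, ↗) = (A , B), where A and B are the standard tableaux with lattice
-- words wA and wB respectively.
ViennotNE : PSet → List ℕ → List ℕ → Set
ViennotNE X wA wB = ReadsAs (RightEnd X) wA × ReadsAs (TopEnd X) wB

{-# OPTIONS --safe #-}
module Submission where

-- Throughout, rows and columns are counted from 0.  After x gromotions of stack(P , Q), the
-- surviving entries of P fill columns of heights h j (the x-th stage of the evacuation of P),
-- and the columns of Q sit intact directly below them: the entry Q k j is in row h j + k.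
-- Indeed the next slide leaves the shape h at a corner (a , j).  From there on, the entry to the
-- right of the hole is either new or lies in row ≥ k of Q when the entry below is Q k j, so the
-- hole drops straight down column j of Q.  The entries of Q that move are therefore Q k j, into
-- row a + k, while the evacuation E of P gets E a j = n ∸ x.  Hence
--   P^NE(prom_{m+1}) = { (Q b j , E a j) | a + b = m },
-- and the columns j of this set are its shadow lines: (Q b j , E a j) lies below
-- (Q b (j+1) , E a (j+1)), and each column is an antichain.  Joins of consecutive points of
-- column j are the points of column j with a + b = m + 1, which gives the ↗-skeleta; the
-- ↙-skeleta follow by rotating both tableaux by 180°.

open import Defs
open import Data.Nat using (ℕ; zero; suc; _+_; _*_; _∸_; _⊔_; _≤_; _<_; z≤n; s≤s; _≤?_; _<?_; _≟_; _≡ᵇ_; _<ᵇ_)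
open import Data.Nat.Properties
open import Data.Nat.DivMod using (m<n⇒m%n≡m; n%n≡0; [m+n]%n≡m%n)
open import Data.Integer as ℤ using (ℤ; +_)
import Data.Integer.Properties as ℤ
open import Data.Bool using (true; false; if_then_else_)
open import Data.Bool.Properties using (T-≡)
open import Data.Maybe using (Maybe; just; nothing; fromMaybe)
import Data.Maybe as Maybe
open import Data.Maybe.Properties using (just-injective)
open import Data.List using (List; []; _∷_; map; foldr; upTo)
open import Data.List.Properties using (map-∘; map-cong-local)
open import Data.List.Membership.Propositional using (_∈_; lose)
open import Data.List.Membership.Propositional.Properties using (∈-map⁺; ∈-map⁻; ∈-upTo⁺; ∈-upTo⁻; ∈-concatMap⁺)
open import Data.List.Relation.Unary.Any using (here; there)
import Data.List.Relation.Unary.All as All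
import Data.List.Relation.Unary.Linked.Properties as Linked
open import Data.Product using (Σ; _×_; _,_; proj₁; proj₂; swap)
open import Data.Product.Properties using (,-injective)
open import Data.Sum using (_⊎_; inj₁; inj₂)
open import Relation.Nullary using (¬_; yes; no; contradiction)
open import Relation.Nullary.Decidable using (decidable-stable; _×-dec_)
open import Relation.Binary.PropositionalEquality
open import Relation.Binary.Definitions using (tri<; tri≈; tri>)
open import Algebra.Properties.CommutativeSemigroup +-commutativeSemigroup using (interchange)
open import Function using (_∘_; id; Equivalence)

-- Shadow lines and skeleta of antidiagonals

≐-sym : ∀ {A B} → A ≐ B → B ≐ A
≐-sym e p = swap (e p)

≐-trans : ∀ {A B C} → A ≐ B → B ≐ C → A ≐ C
≐-trans e e′ p = proj₁ (e′ p) ∘ proj₁ (e p) , proj₂ (e p) ∘ proj₂ (e′ p)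

module _ (d : Dir) where

  Min-mono : ∀ {A B} → A ≐ B → ∀ p → Min d A p → Min d B p
  Min-mono e p (a , m) = proj₁ (e p) a , λ q b → m q (proj₂ (e q) b)

  Min-cong : ∀ {A B} → A ≐ B → Min d A ≐ Min d B
  Min-cong e p = Min-mono e p , Min-mono (≐-sym e) p

  Rest-mono : ∀ {A B} → A ≐ B → ∀ j p → Rest d A j p → Rest d B j p
  Rest-cong : ∀ {A B} → A ≐ B → ∀ j → Rest d A j ≐ Rest d B j
  Rest-mono e zero p = proj₁ (e p)
  Rest-mono e (suc j) p (a , ¬m) =
    Rest-mono e j p a , ¬m ∘ proj₂ (Min-cong (Rest-cong e j) p)
  Rest-cong e j p = Rest-mono e j p , Rest-mono (≐-sym e) j p

  ShadowLine-cong : ∀ {A B} → A ≐ B → ∀ j → ShadowLine d A j ≐ ShadowLine d B j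
  ShadowLine-cong e zero p = (λ ()) , (λ ())
  ShadowLine-cong e (suc j) = Min-cong (Rest-cong e j)

  Region-mono : ∀ {A B} → A ≐ B → ∀ p → Region d A p → Region d B p
  Region-mono e p (p₁ , p₂ , a₁ , a₂ , rest) =
    p₁ , p₂ , proj₁ (e p₁) a₁ , proj₁ (e p₂) a₂ , rest

  SkeletonLine-cong : ∀ {A B} → A ≐ B → SkeletonLine d A ≐ SkeletonLine d B
  SkeletonLine-cong e = Min-cong λ p → Region-mono e p , Region-mono (≐-sym e) p

  Skeleton-mono : ∀ {A B} → A ≐ B → ∀ p → Skeleton d A p → Skeleton d B p
  Skeleton-mono e p (j , 1≤j , s) =
    j , 1≤j , proj₁ (SkeletonLine-cong (ShadowLine-cong e j) p) s

  Skeleton-cong : ∀ {A B} → A ≐ B → Skeleton d A ≐ Skeleton d B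
  Skeleton-cong e p = Skeleton-mono e p , Skeleton-mono (≐-sym e) p

infix 4 _⊢_⊑_ _⊢_⊏_

-- One order per coordinate, reversed for ↙, so that every argument below is made once for both
-- directions.
_⊢_⊑_ : Dir → ℤ → ℤ → Set
↗ ⊢ x ⊑ y = x ℤ.≤ y
↙ ⊢ x ⊑ y = y ℤ.≤ x

_⊢_⊏_ : Dir → ℤ → ℤ → Set
↗ ⊢ x ⊏ y = x ℤ.< y
↙ ⊢ x ⊏ y = y ℤ.< x

⊑-refl : ∀ d {x y} → x ≡ y → d ⊢ x ⊑ y
⊑-refl ↗ refl = ℤ.≤-refl
⊑-refl ↙ refl = ℤ.≤-refl

⊑-trans : ∀ d {x y z} → d ⊢ x ⊑ y → d ⊢ y ⊑ z → d ⊢ x ⊑ z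
⊑-trans ↗ p q = ℤ.≤-trans p q
⊑-trans ↙ p q = ℤ.≤-trans q p

⊑-antisym : ∀ d {x y} → d ⊢ x ⊑ y → d ⊢ y ⊑ x → x ≡ y
⊑-antisym ↗ p q = ℤ.≤-antisym p q
⊑-antisym ↙ p q = ℤ.≤-antisym q p

⊏⇒⊑ : ∀ d {x y} → d ⊢ x ⊏ y → d ⊢ x ⊑ y
⊏⇒⊑ ↗ = ℤ.<⇒≤
⊏⇒⊑ ↙ = ℤ.<⇒≤

⊏⇒⋣ : ∀ d {x y} → d ⊢ x ⊏ y → ¬ d ⊢ y ⊑ x
⊏⇒⋣ ↗ = ℤ.<⇒≱
⊏⇒⋣ ↙ = ℤ.<⇒≱

⊏-trans : ∀ d {x y z} → d ⊢ x ⊏ y → d ⊢ y ⊏ z → d ⊢ x ⊏ z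
⊏-trans ↗ p q = ℤ.<-trans p q
⊏-trans ↙ p q = ℤ.<-trans q p

⊏-⊑-trans : ∀ d {x y z} → d ⊢ x ⊏ y → d ⊢ y ⊑ z → d ⊢ x ⊏ z
⊏-⊑-trans ↗ p q = ℤ.<-≤-trans p q
⊏-⊑-trans ↙ p q = ℤ.≤-<-trans q p

Rel⁺ : ∀ d {a b x y} → d ⊢ a ⊑ x → d ⊢ b ⊑ y → Rel d (a , b) (x , y)
Rel⁺ ↗ p q = p , q
Rel⁺ ↙ p q = p , q

Rel⁻ : ∀ d {a b x y} → Rel d (a , b) (x , y) → d ⊢ a ⊑ x × d ⊢ b ⊑ y
Rel⁻ ↗ = id
Rel⁻ ↙ = id

Rel-refl : ∀ d {p} → Rel d p p
Rel-refl d = Rel⁺ d (⊑-refl d refl) (⊑-refl d refl)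

Rel-trans : ∀ d {p q s} → Rel d p q → Rel d q s → Rel d p s
Rel-trans d u v with Rel⁻ d u | Rel⁻ d v
... | a , b | a′ , b′ = Rel⁺ d (⊑-trans d a a′) (⊑-trans d b b′)

Rel-antisym : ∀ d {p q} → Rel d p q → Rel d q p → p ≡ q
Rel-antisym d u v with Rel⁻ d u | Rel⁻ d v
... | a , b | a′ , b′ = cong₂ _,_ (⊑-antisym d a a′) (⊑-antisym d b b′)

chain-⊏ : ∀ d {N} (φ : ℕ → ℤ) → (∀ i → suc i < N → d ⊢ φ i ⊏ φ (suc i)) →
          ∀ {i i′} → i < i′ → i′ < N → d ⊢ φ i ⊏ φ i′
chain-⊏ d φ step {i} {suc i′} i<i′ i′<N with m<1+n⇒m<n∨m≡n i<i′
... | inj₁ lt   = ⊏-trans d (chain-⊏ d φ step lt (<-trans (n<1+n i′) i′<N)) (step i′ i′<N)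
... | inj₂ refl = step i′ i′<N

-- For ↙ this describes arrays whose entries decrease along rows and columns, such as a tableau
-- rotated by 180°.
record Increasing (d : Dir) (r c : ℕ) (f : ℕ → ℕ → ℤ) : Set where
  field
    row-⊏ : ∀ {i} j → i < r → suc j < c → d ⊢ f i j ⊏ f i (suc j)
    col-⊏ : ∀ i {j} → suc i < r → j < c → d ⊢ f i j ⊏ f (suc i) j

  along-row : ∀ {i j j′} → i < r → j < j′ → j′ < c → d ⊢ f i j ⊏ f i j′
  along-row {i} i<r = chain-⊏ d (f i) λ j → row-⊏ j i<r

  along-col : ∀ {i i′ j} → i < i′ → i′ < r → j < c → d ⊢ f i j ⊏ f i′ j
  along-col {j = j} i<i′ i′<r j<c =
    chain-⊏ d (λ i → f i j) (λ i i<r → col-⊏ i i<r j<c) i<i′ i′<r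

  along-row-⊑ : ∀ {i j j′} → i < r → j ≤ j′ → j′ < c → d ⊢ f i j ⊑ f i j′
  along-row-⊑ i<r j≤j′ j′<c with m≤n⇒m<n∨m≡n j≤j′
  ... | inj₁ lt   = ⊏⇒⊑ d (along-row i<r lt j′<c)
  ... | inj₂ refl = ⊑-refl d refl

  along-col-⊑ : ∀ {i i′ j} → i ≤ i′ → i′ < r → j < c → d ⊢ f i j ⊑ f i′ j
  along-col-⊑ i≤i′ i′<r j<c with m≤n⇒m<n∨m≡n i≤i′
  ... | inj₁ lt   = ⊏⇒⊑ d (along-col lt i′<r j<c)
  ... | inj₂ refl = ⊑-refl d refl

  -- If i < i′, then going down column `j` and right along row `i′` would give a strict increase
  -- from `f i j` to `f i′ j′`.
  reflect-row : ∀ {i i′ j j′} → i′ < r → j′ < c → j ≤ j′ → d ⊢ f i′ j′ ⊑ f i j → i′ ≤ i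
  reflect-row {i} {i′} i′<r j′<c j≤j′ le with i′ ≤? i
  ... | yes i′≤i = i′≤i
  ... | no  i′≰i = contradiction le (⊏⇒⋣ d
        (⊏-⊑-trans d (along-col (≰⇒> i′≰i) i′<r (≤-<-trans j≤j′ j′<c)) (along-row-⊑ i′<r j≤j′ j′<c)))

same-sum : ∀ {a b a′ b′} → a + b ≡ a′ + b′ → a′ ≤ a → b′ ≤ b → a′ ≡ a × b′ ≡ b
same-sum {a} {b} {a′} {b′} eq a′≤a b′≤b = a≡ , sym (+-cancelˡ-≡ a b b′ (trans eq (cong (_+ b′) a≡)))
  where
  a≡ : a′ ≡ a
  a≡ = ≤-antisym a′≤a (+-cancelʳ-≤ b a a′ (≤-trans (≤-reflexive eq) (+-monoʳ-≤ a′ b′≤b)))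

-- For fixed `m` a larger row `a` of `g` goes with a smaller row `b` of `f`, so each column is an
-- antichain when `f` and `g` are increasing.
Col : (r c : ℕ) (f g : ℕ → ℕ → ℤ) → ℕ → ℕ → PSet
Col r c f g m j p = Σ ℕ λ a → Σ ℕ λ b →
  a < r × b < r × j < c × a + b ≡ m × p ≡ (f b j , g a j)

Diag : (r c : ℕ) (f g : ℕ → ℕ → ℤ) → ℕ → PSet
Diag r c f g m p = Σ ℕ λ j → Col r c f g m j p

module ShadowLines {d r c f g} (F : Increasing d r c f) (G : Increasing d r c g) where

  module F = Increasing F
  module G = Increasing G

  Column : ℕ → ℕ → PSet
  Column = Col r c f g

  Diagonal : ℕ → PSet
  Diagonal = Diag r c f g

  From : ℕ → ℕ → PSet
  From m j p = Σ ℕ λ j′ → j ≤ j′ × Column m j′ p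

  -- `reflect-row` in each coordinate gives a′ ≤ a and b′ ≤ b; as both pairs have sum `m`, they are
  -- equal. Strict increase along row `b` then rules out j < j′.
  dominated : ∀ {m j j′ p p′} → j ≤ j′ → Column m j p → Column m j′ p′ → Rel d p′ p →
              j′ ≡ j × p′ ≡ p
  dominated {j = j} {j′} j≤j′ (a , b , a<r , b<r , j<c , s , refl) (a′ , b′ , a′<r , b′<r , j′<c , s′ , refl) rel
    with Rel⁻ d rel
  ... | fle , gle
    with same-sum (trans s (sym s′)) (G.reflect-row a′<r j′<c j≤j′ gle) (F.reflect-row b′<r j′<c j≤j′ fle)
  ... | refl , refl with m≤n⇒m<n∨m≡n j≤j′
  ... | inj₁ lt   = contradiction fle (⊏⇒⋣ d (F.along-row b<r lt j′<c))
  ... | inj₂ refl = refl , refl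

  -- A point of a later column has the point of column `j` with the same rows `a` and `b` strictly
  -- below it; the points of column `j` are minimal by `dominated`.
  Min-From : ∀ m j → Min d (From m j) ≐ Column m j
  Min-From m j p = to , from
    where
    to : Min d (From m j) p → Column m j p
    to ((j′ , j≤j′ , a , b , a<r , b<r , j′<c , s , refl) , min)
      with m≤n⇒m<n∨m≡n j≤j′
    ... | inj₂ refl = a , b , a<r , b<r , j′<c , s , refl
    ... | inj₁ lt   = contradiction (⊑-refl d (sym (proj₁ (,-injective eq)))) (⊏⇒⋣ d (F.along-row b<r lt j′<c))
      where
      eq : (f b j , g a j) ≡ (f b j′ , g a j′)
      eq = min _ (j , ≤-refl , a , b , a<r , b<r , <-trans lt j′<c , s , refl)
             (Rel⁺ d (F.along-row-⊑ b<r j≤j′ j′<c) (G.along-row-⊑ a<r j≤j′ j′<c))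
    from : Column m j p → Min d (From m j) p
    from x = (j , ≤-refl , x) , λ { q (j′ , j≤j′ , y) rel → proj₂ (dominated j≤j′ x y rel) }

  Rest-Diagonal : ∀ m j → Rest d (Diagonal m) j ≐ From m j
  Rest-Diagonal m zero p = (λ { (j , x) → j , z≤n , x }) , λ { (j , _ , x) → j , x }
  Rest-Diagonal m (suc j) p = to , from
    where
    line : Min d (Rest d (Diagonal m) j) ≐ Column m j
    line = ≐-trans (Min-cong d (Rest-Diagonal m j)) (Min-From m j)
    to : Rest d (Diagonal m) (suc j) p → From m (suc j) p
    to (x , ¬min) with proj₁ (Rest-Diagonal m j p) x
    ... | j′ , j≤j′ , y with m≤n⇒m<n∨m≡n j≤j′
    ...   | inj₁ lt   = j′ , lt , y
    ...   | inj₂ refl = contradiction (proj₂ (line p) y) ¬min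
    from : From m (suc j) p → Rest d (Diagonal m) (suc j) p
    from (j′ , j<j′ , y) = proj₂ (Rest-Diagonal m j p) (j′ , <⇒≤ j<j′ , y) ,
      -- A removed point lies in column `j`; `dominated`, applied to this point and itself, shows
      -- that it cannot lie in column j′ > j as well.
      λ min → <-irrefl (sym (proj₁ (dominated (<⇒≤ j<j′) (proj₁ (line p) min) y (Rel-refl d)))) j<j′

  ShadowLine-Diagonal : ∀ m j → ShadowLine d (Diagonal m) (suc j) ≐ Column m j
  ShadowLine-Diagonal m j = ≐-trans (Min-cong d (Rest-Diagonal m j)) (Min-From m j)

  -- The witness has rows a + 1 and `b`. Its first coordinate is that of the first point, and its
  -- second is at most that of the second point, in the order of `d`, because a + 1 ≤ a′.
  above-join : ∀ {m j p a b a′ b′} → a < a′ → a + b ≡ m → a′ < r → b < r → j < c →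
               Rel d (f b j , g a j) p → Rel d (f b′ j , g a′ j) p →
               Σ Pt λ q → Column (suc m) j q × Rel d q p
  above-join a<a′ s a′<r b<r j<c rel rel′ =
    _ , (_ , _ , ≤-<-trans a<a′ a′<r , b<r , j<c , cong suc s , refl) ,
    Rel⁺ d (proj₁ (Rel⁻ d rel)) (⊑-trans d (G.along-col-⊑ a<a′ a′<r j<c) (proj₂ (Rel⁻ d rel′)))

  Region⇒Column : ∀ {m j} p → Region d (Column m j) p → Σ Pt λ q → Column (suc m) j q × Rel d q p
  Region⇒Column p (_ , _ , (a , b , a<r , b<r , j<c , s , refl) , (a′ , b′ , a′<r , b′<r , _ , s′ , refl) , ≢ , rel , rel′)
    with <-cmp a a′
  ... | tri< lt _ _ = above-join lt s a′<r b<r j<c rel rel′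
  ... | tri> _ _ gt = above-join gt s′ a<r b′<r j<c rel′ rel
  ... | tri≈ _ refl _ = contradiction
        (cong (λ k → f k _ , g a _) (+-cancelˡ-≡ a b b′ (trans s (sym s′)))) ≢

  -- The point with rows a + 1 and b + 1 is the join of those with rows (a , b + 1) and (a + 1 , b).
  -- The bound r ≤ m + 1 makes both rows positive: if one were 0, the other would be m + 1 ≥ r.
  Column⇒Region : ∀ {m j} → r ≤ suc m → ∀ p → Column (suc m) j p → Region d (Column m j) p
  Column⇒Region {m} r≤ p (zero , b , _ , b<r , _ , s , _) =
    contradiction (<-≤-trans b<r (≤-trans r≤ (≤-reflexive (sym s)))) (<-irrefl refl)
  Column⇒Region {m} r≤ p (suc a , zero , a<r , _ , _ , s , _) =
    contradiction (<-≤-trans a<r (≤-trans r≤ (≤-reflexive (sym (trans (sym (+-identityʳ (suc a))) s))))) (<-irrefl refl)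
  Column⇒Region {m} r≤ p (suc a , suc b , a<r , b<r , j<c , s , refl) =
    _ , _ ,
    (a , suc b , <-trans (n<1+n a) a<r , b<r , j<c , suc-injective s , refl) ,
    (suc a , b , a<r , <-trans (n<1+n b) b<r , j<c , trans (sym (+-suc a b)) (suc-injective s) , refl) ,
    (λ eq → ⊏⇒⋣ d f⊏ (⊑-refl d (proj₁ (,-injective eq)))) ,
    Rel⁺ d (⊑-refl d refl) (⊏⇒⊑ d (G.col-⊏ a a<r j<c)) ,
    Rel⁺ d (⊏⇒⊑ d f⊏) (⊑-refl d refl)
    where f⊏ = F.col-⊏ b b<r j<c

  -- The next column is contained in the region, every point of the region lies above one of its
  -- points, and it is an antichain; so it consists of the minimal points.
  SkeletonLine-Column : ∀ {m j} → r ≤ suc m → SkeletonLine d (Column m j) ≐ Column (suc m) j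
  SkeletonLine-Column {m} {j} r≤ p = to , from
    where
    to : SkeletonLine d (Column m j) p → Column (suc m) j p
    to (x , min) with Region⇒Column p x
    ... | q , y , rel = subst (Column (suc m) j) (min q (Column⇒Region r≤ q y) rel) y
    from : Column (suc m) j p → SkeletonLine d (Column m j) p
    from y = Column⇒Region r≤ p y , below
      where
      below : ∀ q → Region d (Column m j) q → Rel d q p → q ≡ p
      below q x rel with Region⇒Column q x
      ... | q′ , y′ , rel′ with proj₂ (dominated ≤-refl y y′ (Rel-trans d rel′ rel))
      ...   | refl = Rel-antisym d rel rel′

  Skeleton-Diagonal : ∀ {m} → r ≤ suc m → Skeleton d (Diagonal m) ≐ Diagonal (suc m)
  Skeleton-Diagonal {m} r≤ p = to , λ { (j , y) → suc j , s≤s z≤n , proj₂ (line j p) y }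
    where
    line : ∀ j → SkeletonLine d (ShadowLine d (Diagonal m) (suc j)) ≐ Column (suc m) j
    line j = ≐-trans (SkeletonLine-cong d (ShadowLine-Diagonal m j)) (SkeletonLine-Column r≤)
    to : Skeleton d (Diagonal m) p → Diagonal (suc m) p
    to (suc j , _ , x) = j , proj₁ (line j p) x

  module Iterated {X m} (X≐ : X ≐ Diagonal m) (r≤ : r ≤ suc m) where

    SkeletonIter-Diagonal : ∀ k → SkeletonIter d X k ≐ Diagonal (k + m)
    SkeletonIter-Diagonal zero    = X≐
    -- Each skeleton raises the row sum by one, so the bound r ≤ m + 1 persists.
    SkeletonIter-Diagonal (suc k) = ≐-trans (Skeleton-cong d (SkeletonIter-Diagonal k))
      (Skeleton-Diagonal (≤-trans r≤ (s≤s (m≤n+m m k))))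

    ShadowLine-SkeletonIter : ∀ k j → ShadowLine d (SkeletonIter d X k) (suc j) ≐ Column (k + m) j
    ShadowLine-SkeletonIter k j =
      ≐-trans (ShadowLine-cong d (SkeletonIter-Diagonal k) (suc j)) (ShadowLine-Diagonal (k + m) j)

    SkeletonLine-ShadowLine : ∀ k j → 1 ≤ j →
      SkeletonLine d (ShadowLine d (SkeletonIter d X k) j) ≐ ShadowLine d (SkeletonIter d X (suc k)) j
    SkeletonLine-ShadowLine k (suc j) _ =
      ≐-trans (SkeletonLine-cong d (ShadowLine-SkeletonIter k j))
        (≐-trans (SkeletonLine-Column (≤-trans r≤ (s≤s (m≤n+m m k))))
          (≐-sym (ShadowLine-SkeletonIter (suc k) j)))

-- Words of Viennot's construction

entry : Filling → ℕ → ℕ → ℕ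
entry T i j = fromMaybe 0 (T i j)

cell∈ : ∀ {R c i j} → i < R → j < c → (i , j) ∈ cells R c
cell∈ {R} {c} {i} i<R j<c = ∈-concatMap⁺ (λ i → map (i ,_) (upTo c))
  (lose (∈-upTo⁺ i<R) (∈-map⁺ (i ,_) (∈-upTo⁺ j<c)))

≡ᵇ-refl : ∀ v → (v ≡ᵇ v) ≡ true
≡ᵇ-refl zero    = refl
≡ᵇ-refl (suc v) = ≡ᵇ-refl v

≡ᵇ-sound : ∀ u v → (u ≡ᵇ v) ≡ true → u ≡ v
≡ᵇ-sound zero    zero    _  = refl
≡ᵇ-sound (suc u) (suc v) eq = cong suc (≡ᵇ-sound u v eq)

isJust≡-sound : ∀ m v → isJust≡ m v ≡ true → m ≡ just v
isJust≡-sound (just u) v eq = cong just (≡ᵇ-sound u v eq)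

module Tableau {r c T} (S : IsSYT r c T) where
  open IsSYT S

  inBox : ∀ {i j v} → T i j ≡ just v → i < r × j < c
  inBox {i} {j} eq = decidable-stable (i <? r ×-dec j <? c)
    λ out → contradiction (trans (sym eq) (proj₂ (shape i j) out)) λ ()

  entry-just : ∀ {i j} → i < r → j < c → T i j ≡ just (entry T i j)
  entry-just {i} {j} i<r j<c with T i j in eq
  ... | just _  = refl
  ... | nothing = contradiction (i<r , j<c) (proj₁ (shape i j) eq)

  increasing : Increasing ↗ r c (λ i j → + entry T i j)
  increasing = record
    { row-⊏ = λ {i} j i<r j<c → ℤ.+<+ (rowInc i j _ _
        (entry-just i<r (<-trans (n<1+n j) j<c)) (entry-just i<r j<c))
    ; col-⊏ = λ i {j} i<r j<c → ℤ.+<+ (colInc i j _ _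
        (entry-just (<-trans (n<1+n i) i<r) j<c) (entry-just i<r j<c)) }

  rowOf-entry : ∀ {i j v} → T i j ≡ just v → rowOf r c T v ≡ suc i
  rowOf-entry {i} {j} {v} eq = search (cells r c) (cell∈ (proj₁ (inBox eq)) (proj₂ (inBox eq)))
    where
    search : ∀ L → (i , j) ∈ L →
      foldr (λ ij s → if isJust≡ (T (proj₁ ij) (proj₂ ij)) v then suc (proj₁ ij) else s) 0 L ≡ suc i
    search ((i′ , j′) ∷ L) ij∈ with isJust≡ (T i′ j′) v in hit
    ... | true = cong suc (proj₁ (injective i′ j′ i j v (isJust≡-sound _ v hit) eq))
    ... | false with ij∈
    ...   | there ij∈L = search L ij∈L
    ...   | here refl with trans (sym hit) (trans (cong (λ m → isJust≡ m v) eq) (≡ᵇ-refl v))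
    ...     | ()

  -- Made total in order to be mapped over a list; the value (0 , 0) stands for numbers outside 1,
  -- ..., r * c.
  position : ℕ → ℕ × ℕ
  position v with 1 ≤? v | v ≤? r * c
  ... | yes 1≤v | yes v≤n = let i , j , _ = surjective v 1≤v v≤n in i , j
  ... | _       | _       = 0 , 0

  position-entry : ∀ v → 1 ≤ v → v ≤ r * c → T (proj₁ (position v)) (proj₂ (position v)) ≡ just v
  position-entry v 1≤v v≤n with 1 ≤? v | v ≤? r * c
  ... | yes p | yes q = proj₂ (proj₂ (surjective v p q))
  ... | no ¬p | _     = contradiction 1≤v ¬p
  ... | yes _ | no ¬q = contradiction v≤n ¬q

  -- If line j + 1 of the `i`-th skeleton ends at the entry in cell (i , j), the ends are exactly 1,
  -- ..., r * c, and the end v carries the label i + 1, which is the row of v counted from 1.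
  ReadsAs-latticeWord : (E : ℕ → ℕ → ℤ → Set) →
    (∀ {i j z} → E i j z → Σ ℕ λ j′ → Σ ℕ λ v → j ≡ suc j′ × T i j′ ≡ just v × z ≡ + v) →
    (∀ {i j v} → T i j ≡ just v → E i (suc j) (+ v)) →
    ReadsAs E (latticeWord r c T)
  ReadsAs-latticeWord E to from = map end word , spec , linked , labels
    where
    word : List ℕ
    word = map suc (upTo (r * c))
    end : ℕ → ℤ × ℕ × ℕ
    end v = + v , proj₁ (position v) , suc (proj₂ (position v))
    bounds : ∀ {v} → v ∈ word → 1 ≤ v × v ≤ r * c
    bounds v∈ with ∈-map⁻ suc v∈
    ... | k , k∈ , refl = s≤s z≤n , ∈-upTo⁻ k∈
    spec : ∀ z i j → ((z , i , j) ∈ map end word → E i j z) × (E i j z → (z , i , j) ∈ map end word)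
    spec z i j = sound , complete
      where
      sound : (z , i , j) ∈ map end word → E i j z
      sound e∈ with ∈-map⁻ end e∈
      ... | v , v∈ , refl = from (position-entry v (proj₁ (bounds v∈)) (proj₂ (bounds v∈)))
      complete : E i j z → (z , i , j) ∈ map end word
      complete e with to e
      ... | j′ , zero , refl , eq , refl with range i j′ 0 eq
      ...   | () , _
      complete e | j′ , suc v , refl , eq , refl =
        subst (_∈ map end word) end≡ (∈-map⁺ end (∈-map⁺ suc (∈-upTo⁺ v<n)))
        where
        v<n = proj₂ (range i j′ (suc v) eq)
        end≡ : end (suc v) ≡ (+ suc v , i , suc j′)
        end≡ with injective _ _ _ _ (suc v) (position-entry (suc v) (s≤s z≤n) v<n) eq
        ... | p , q = cong₂ (λ a b → + suc v , a , suc b) p q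
    linked = Linked.map⁺ (Linked.map⁺ (Linked.applyUpTo⁺₂ (λ k → k) (r * c) λ k → ℤ.+<+ (n<1+n (suc k))))
    labels : latticeWord r c T ≡ map (λ e → suc (proj₁ (proj₂ e))) (map end word)
    labels = trans
      (map-cong-local (All.tabulate λ {v} v∈ →
        rowOf-entry (position-entry v (proj₁ (bounds v∈)) (proj₂ (bounds v∈)))))
      (map-∘ word)

m<n⇒pred<n : ∀ {m n} → m < n → n ∸ 1 < n
m<n⇒pred<n {n = suc n} _ = n<1+n n

-- Rotation of both tableaux by 180°

module Reversal (r c : ℕ) where

  reverse : (ℕ → ℕ → ℤ) → ℕ → ℕ → ℤ
  reverse f i j = f (r ∸ suc i) (c ∸ suc j)

  ∸suc-< : ∀ {i n} → i < n → n ∸ suc i < n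
  ∸suc-< {i} {suc n} _ = s≤s (m∸n≤m n i)

  reverse-increasing : ∀ {f} → Increasing ↗ r c f → Increasing ↙ r c (reverse f)
  reverse-increasing F = record
    { row-⊏ = λ j i<r j<c →
        along-row (∸suc-< i<r) (∸-monoʳ-< (n<1+n (suc j)) j<c) (∸suc-< (<-trans (n<1+n j) j<c))
    ; col-⊏ = λ i i<r j<c →
        along-col (∸-monoʳ-< (n<1+n (suc i)) i<r) (∸suc-< (<-trans (n<1+n i) i<r)) (∸suc-< j<c) }
    where open Increasing F

  ∸suc-involutive : ∀ {i n} → i < n → n ∸ suc (n ∸ suc i) ≡ i
  ∸suc-involutive {i} {suc n} (s≤s i≤n) = m∸[m∸n]≡n i≤n

  +-∸suc : ∀ {i n} → i < n → i + (n ∸ suc i) ≡ n ∸ 1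
  +-∸suc {i} {suc n} (s≤s i≤n) = m+[n∸m]≡n i≤n

  reversed-sum : ∀ {a b m m′} → a < r → b < r → a + b ≡ m → m + m′ ≡ (r ∸ 1) + (r ∸ 1) →
                 (r ∸ suc a) + (r ∸ suc b) ≡ m′
  reversed-sum {a} {b} {m} {m′} a<r b<r refl eq = +-cancelˡ-≡ (a + b) _ _ (begin
    (a + b) + ((r ∸ suc a) + (r ∸ suc b)) ≡⟨ interchange a b _ _ ⟩
    (a + (r ∸ suc a)) + (b + (r ∸ suc b)) ≡⟨ cong₂ _+_ (+-∸suc a<r) (+-∸suc b<r) ⟩
    (r ∸ 1) + (r ∸ 1)                     ≡⟨ sym eq ⟩
    (a + b) + m′                          ∎)
    where
    open ≡-Reasoning

  -- The rotation replaces rows `a` and `b` by r - 1 - a and r - 1 - b, hence the row sum m by 2 (r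
  -- - 1) - m, while the points stay in place. Raising the row sum after the rotation lowers it
  -- before.
  Diag-reverse : ∀ f g {m m′} → m + m′ ≡ (r ∸ 1) + (r ∸ 1) →
                 Diag r c f g m ≐ Diag r c (reverse f) (reverse g) m′
  Diag-reverse f g {m} {m′} eq p = to , from
    where
    to : Diag r c f g m p → Diag r c (reverse f) (reverse g) m′ p
    to (j , a , b , a<r , b<r , j<c , s , refl) =
      c ∸ suc j , r ∸ suc a , r ∸ suc b , ∸suc-< a<r , ∸suc-< b<r , ∸suc-< j<c ,
      reversed-sum a<r b<r s eq ,
      sym (cong₂ _,_ (cong₂ f (∸suc-involutive b<r) (∸suc-involutive j<c))
                     (cong₂ g (∸suc-involutive a<r) (∸suc-involutive j<c)))
    from : Diag r c (reverse f) (reverse g) m′ p → Diag r c f g m p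
    from (j , a , b , a<r , b<r , j<c , s , refl) =
      c ∸ suc j , r ∸ suc a , r ∸ suc b , ∸suc-< a<r , ∸suc-< b<r , ∸suc-< j<c ,
      reversed-sum a<r b<r s (trans (+-comm m′ m) eq) , refl

-- Ends of the shadow lines in Viennot's construction

module Viennot {r c A B} (SA : IsSYT r c A) (SB : IsSYT r c B) {X : PSet}
  (X≐ : X ≐ Diag r c (λ i j → + entry B i j) (λ i j → + entry A i j) (r ∸ 1)) where

  module TA = Tableau SA
  module TB = Tableau SB
  open ShadowLines TB.increasing TA.increasing
  open Iterated X≐ (m≤n+m∸n r 1)

  <r⇒≤pred : ∀ {b} → b < r → b ≤ r ∸ 1
  <r⇒≤pred = ∸-monoˡ-≤ 1

  -- Points of the `i`-th skeleton have row sum i + (r - 1). As one row is at most r - 1, the other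
  -- is at least `i`; the extreme point of a line is the one with equality.
  first-index : ∀ {a b i} → b < r → a + b ≡ i + (r ∸ 1) → i ≤ a
  first-index {a} {b} {i} b<r eq =
    +-cancelʳ-≤ (r ∸ 1) i a (≤-trans (≤-reflexive (sym eq)) (+-monoʳ-≤ a (<r⇒≤pred b<r)))

  right-end : ∀ {i j z} → RightEnd X i j z →
              Σ ℕ λ j′ → Σ ℕ λ v → j ≡ suc j′ × A i j′ ≡ just v × z ≡ + v
  right-end {i} {suc j} (_ , (x , drawn) , lowest) with proj₁ (ShadowLine-SkeletonIter i j _) drawn
  ... | a , b , a<r , b<r , j<c , s , refl = j , _ , refl , TA.entry-just i<r j<c ,
        -- The point with rows `i` and r - 1 lies on the line; its height is the entry of `A` in
        -- cell (i , j).
        ⊑-antisym ↗ (lowest _ (proj₂ (ShadowLine-SkeletonIter i j _)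
            (i , r ∸ 1 , i<r , m<n⇒pred<n b<r , j<c , refl , refl)))
          (G.along-col-⊑ i≤a a<r j<c)
    where
    i≤a = first-index b<r s
    i<r = ≤-<-trans i≤a a<r

  right-end⁺ : ∀ {i j v} → A i j ≡ just v → RightEnd X i (suc j) (+ v)
  right-end⁺ {i} {j} {v} eq with TA.inBox eq
  ... | i<r , j<c = s≤s z≤n ,
        (_ , proj₂ (ShadowLine-SkeletonIter i j _)
          (i , r ∸ 1 , i<r , m<n⇒pred<n i<r , j<c , refl , cong₂ _,_ refl v≡)) ,
        λ p drawn → lowest p (proj₁ (ShadowLine-SkeletonIter i j p) drawn)
    where
    v≡ : + v ≡ + entry A i j
    v≡ = cong +_ (just-injective (trans (sym eq) (TA.entry-just i<r j<c)))
    lowest : ∀ p → Column (i + (r ∸ 1)) j p → + v ℤ.≤ proj₂ p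
    lowest p (a , b , a<r , b<r , _ , s , refl) =
      ℤ.≤-trans (ℤ.≤-reflexive v≡) (G.along-col-⊑ (first-index b<r s) a<r j<c)

  top-end : ∀ {i j z} → TopEnd X i j z →
            Σ ℕ λ j′ → Σ ℕ λ v → j ≡ suc j′ × B i j′ ≡ just v × z ≡ + v
  top-end {i} {suc j} (_ , (y , drawn) , leftmost) with proj₁ (ShadowLine-SkeletonIter i j _) drawn
  ... | a , b , a<r , b<r , j<c , s , refl = j , _ , refl , TB.entry-just i<r j<c ,
        ⊑-antisym ↗ (leftmost _ (proj₂ (ShadowLine-SkeletonIter i j _)
            (r ∸ 1 , i , m<n⇒pred<n b<r , i<r , j<c , +-comm (r ∸ 1) i , refl)))
          (F.along-col-⊑ i≤b b<r j<c)
    where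
    i≤b = first-index a<r (trans (+-comm b a) s)
    i<r = ≤-<-trans i≤b b<r

  top-end⁺ : ∀ {i j v} → B i j ≡ just v → TopEnd X i (suc j) (+ v)
  top-end⁺ {i} {j} {v} eq with TB.inBox eq
  ... | i<r , j<c = s≤s z≤n ,
        (_ , proj₂ (ShadowLine-SkeletonIter i j _)
          (r ∸ 1 , i , m<n⇒pred<n i<r , i<r , j<c , +-comm (r ∸ 1) i , cong₂ _,_ v≡ refl)) ,
        λ p drawn → leftmost p (proj₁ (ShadowLine-SkeletonIter i j p) drawn)
    where
    v≡ : + v ≡ + entry B i j
    v≡ = cong +_ (just-injective (trans (sym eq) (TB.entry-just i<r j<c)))
    leftmost : ∀ p → Column (i + (r ∸ 1)) j p → + v ℤ.≤ proj₁ p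
    leftmost p (a , b , a<r , b<r , _ , s , refl) =
      ℤ.≤-trans (ℤ.≤-reflexive v≡) (F.along-col-⊑ (first-index a<r (trans (+-comm b a) s)) b<r j<c)

  ViennotNE-Diag : ViennotNE X (latticeWord r c A) (latticeWord r c B)
  ViennotNE-Diag = TA.ReadsAs-latticeWord (RightEnd X) right-end right-end⁺ ,
                   TB.ReadsAs-latticeWord (TopEnd X) top-end top-end⁺

-- Jeu de taquin slides of a stacked tableau

update-hit : ∀ T i j v → update T i j v i j ≡ v
update-hit T i j v rewrite ≡ᵇ-refl i | ≡ᵇ-refl j = refl

update-miss : ∀ T {i j} v {a b} → ¬ (a ≡ i × b ≡ j) → update T i j v a b ≡ T a b
update-miss T {i} {j} v {a} {b} ≢ with a ≡ᵇ i in e | b ≡ᵇ j in e′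
... | true  | true  = contradiction (≡ᵇ-sound a i e , ≡ᵇ-sound b j e′) ≢
... | true  | false = refl
... | false | _     = refl

update-all : ∀ {T i j v} (C : ℕ → ℕ → Maybe ℕ → Set) →
             (∀ a b → ¬ (a ≡ i × b ≡ j) → C a b (T a b)) → C i j v →
             ∀ a b → C a b (update T i j v a b)
update-all {T} {i} {j} {v} C other at-hole a b with a ≟ i | b ≟ j
... | yes refl | yes refl = subst (C a b) (sym (update-hit T a b v)) at-hole
... | yes _    | no b≢j   = subst (C a b) (sym (update-miss T v (b≢j ∘ proj₂))) (other a b (b≢j ∘ proj₂))
... | no a≢i   | _        = subst (C a b) (sym (update-miss T v (a≢i ∘ proj₁))) (other a b (a≢i ∘ proj₁))

-- One step of jeu de taquin: `v` moves into the hole at (i , j) and leaves the hole at (i′ , j′).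
shift : Filling → ℕ → ℕ → ℕ → ℕ → ℕ → Filling
shift T i j i′ j′ v = update (update T i j (just v)) i′ j′ nothing

shift-all : ∀ {T i j i′ j′ v} (C : ℕ → ℕ → Maybe ℕ → Set) →
            (∀ a b → ¬ (a ≡ i′ × b ≡ j′) → ¬ (a ≡ i × b ≡ j) → C a b (T a b)) → C i j (just v) →
            ∀ a b → ¬ (a ≡ i′ × b ≡ j′) → C a b (shift T i j i′ j′ v a b)
shift-all {T} {i} {j} {i′} {j′} {v} C other at-hole a b ≢′ =
  subst (C a b) (sym (update-miss (update T i j (just v)) nothing ≢′))
    (update-all (λ a b m → ¬ (a ≡ i′ × b ≡ j′) → C a b m) (λ a b ≢ ≢′ → other a b ≢′ ≢) (λ _ → at-hole) a b ≢′)

<ᵇ-true : ∀ {u v} → u < v → (u <ᵇ v) ≡ true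
<ᵇ-true = Equivalence.to T-≡ ∘ <⇒<ᵇ

<ᵇ-false : ∀ {u v} → v ≤ u → (u <ᵇ v) ≡ false
<ᵇ-false {u} {v} v≤u with u <ᵇ v in e
... | false = refl
... | true  = contradiction (<ᵇ⇒< u v (Equivalence.from T-≡ e)) (≤⇒≯ v≤u)

addMove : ℕ × ℕ → SlideResult → SlideResult
addMove m (T , h , ms) = T , h , m ∷ ms

slide-stop : ∀ f T i j → T i (suc j) ≡ nothing → T (suc i) j ≡ nothing →
             slide (suc f) T i j ≡ (T , (i , j) , [])
slide-stop f T i j right down rewrite right | down = refl

-- The hypothesis on the cell below is vacuous when that cell is empty, so one rule covers both ways
-- in which `slide` moves right.
slide-right : ∀ f T i j {u} → T i (suc j) ≡ just u → (∀ v → T (suc i) j ≡ just v → u < v) →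
              slide (suc f) T i j ≡ slide f (shift T i j i (suc j) u) i (suc j)
slide-right f T i j {u} right down rewrite right with T (suc i) j
... | nothing = refl
... | just v rewrite <ᵇ-true (down v refl) = refl

-- The inequality is weak because `slide` moves down unless the right neighbour is strictly smaller.
slide-down : ∀ f T i j {v} → T (suc i) j ≡ just v → (∀ u → T i (suc j) ≡ just u → v ≤ u) →
             slide (suc f) T i j ≡ addMove (i , v) (slide f (shift T i j (suc i) j v) (suc i) j)
slide-down f T i j {v} down right rewrite down with T i (suc j)
... | nothing = refl
... | just u rewrite <ᵇ-false {u} {v} (right u refl) = refl

lookup-hit : ∀ i v ms → lookupRow i ((i , v) ∷ ms) ≡ v
lookup-hit i v ms rewrite ≡ᵇ-refl i = refl

lookup-miss : ∀ {a i} v ms → i < a → lookupRow a ((i , v) ∷ ms) ≡ lookupRow a ms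
lookup-miss {a} {i} v ms i<a with a ≡ᵇ i in e
... | false = refl
... | true  = contradiction i<a (<-irrefl (sym (≡ᵇ-sound a i e)))

-- Fuel plus the coordinates of the hole stays at least rows plus columns, since each move trades
-- one unit of fuel for one step right or down. By `out-of-fuel` the fuel then lasts while the hole
-- is in the rectangle.
fuel-step : ∀ {N} f i j → N ≤ suc f + (i + j) → N ≤ f + (i + suc j)
fuel-step f i j le =
  ≤-trans le (≤-reflexive (trans (sym (+-suc f (i + j))) (cong (λ v → f + v) (sym (+-suc i j)))))

fuel-step′ : ∀ {N} f i j → N ≤ suc f + (i + j) → N ≤ f + (suc i + j)
fuel-step′ f i j le = ≤-trans le (≤-reflexive (sym (+-suc f (i + j))))

out-of-fuel : ∀ {R c i j} → i < R → j < c → ¬ (R + c ≤ i + j)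
out-of-fuel i<R j<c = <⇒≱ (+-mono-< i<R j<c)

lower : (ℕ → ℕ) → ℕ → ℕ → ℕ
lower h b j = if j ≡ᵇ b then h j ∸ 1 else h j

lower-hit : ∀ h {a b} → suc a ≡ h b → lower h b b ≡ a
lower-hit h {b = b} eq rewrite ≡ᵇ-refl b | sym eq = refl

lower-miss : ∀ h {b j} → j ≢ b → lower h b j ≡ h j
lower-miss h {b} {j} ≢ with j ≡ᵇ b in e
... | false = refl
... | true  = contradiction (≡ᵇ-sound j b e) ≢

-- The lower tableau enters through its entries `q`. The assumption `q-right` decides the comparison
-- when both neighbours of the hole belong to the lower tableau.
module Gromotion (r c n : ℕ) (q : ℕ → ℕ → ℕ)
  (q≥1 : ∀ {k j} → k < r → j < c → 1 ≤ q k j)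
  (q≤n : ∀ {k j} → k < r → j < c → q k j ≤ n)
  (q-right : ∀ {k k′ j} → k ≤ k′ → k′ < r → suc j < c → q k j < q k′ (suc j)) where

  -- A partition inside the r × c rectangle, given by its column lengths.
  record Heights (h : ℕ → ℕ) : Set where
    field
      antitone : ∀ j → h (suc j) ≤ h j
      bounded  : ∀ j → h j ≤ r
      outside  : ∀ {j} → c ≤ j → h j ≡ 0

    in-columns : ∀ {i j} → i < h j → j < c
    in-columns {i} {j} i<h with j <? c
    ... | yes j<c = j<c
    ... | no  j≮c = contradiction (subst (i <_) (outside (≮⇒≥ j≮c)) i<h) λ ()

  -- Contents m of cell (i , j) after x gromotions; h and cur are the shape and the filling of
  -- what is left of the upper tableau.
  data Cell (h : ℕ → ℕ) (cur : Filling) (x i j : ℕ) (m : Maybe ℕ) : Set where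
    old : i < h j → m ≡ cur i j → Cell h cur x i j m
    mid : ∀ k → k < r → j < c → i ≡ h j + k → m ≡ just (n + q k j) → Cell h cur x i j m
    new : ∀ u → j < c → h j + r ≤ i → i < r + r → n + n < u → u ≤ n + n + x → m ≡ just u →
          Cell h cur x i j m
    out : ¬ (i < r + r × j < c) → m ≡ nothing → Cell h cur x i j m

  AllBut : (ℕ → ℕ) → Filling → ℕ → Filling → ℕ → ℕ → Set
  AllBut h cur x T a b = ∀ i j → ¬ (i ≡ a × j ≡ b) → Cell h cur x i j (T i j)

  module _ {h : ℕ → ℕ} {cur : Filling} {x : ℕ} (H : Heights h) where
    open Heights H

    -- The four kinds of cell occupy disjoint sets of positions, so the position of a cell
    -- determines its kind, here and in the next two lemmas.
    Cell-mid : ∀ {i j m k} → Cell h cur x i j m → k < r → j < c → i ≡ h j + k → m ≡ just (n + q k j)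
    Cell-mid {j = j} (old i<h _) k<r j<c refl = contradiction (m≤m+n (h j) _) (<⇒≱ i<h)
    Cell-mid {j = j} {k = k} (mid k′ _ _ eq m≡) k<r j<c refl with +-cancelˡ-≡ (h j) k k′ eq
    ... | refl = m≡
    Cell-mid {j = j} (new u _ le _ _ _ _) k<r j<c refl =
      contradiction (+-cancelˡ-≤ (h j) _ _ le) (<⇒≱ k<r)
    Cell-mid {j = j} (out ¬in _) k<r j<c refl =
      contradiction (+-mono-≤-< (bounded j) k<r , j<c) ¬in

    Cell-new : ∀ {i j m} → Cell h cur x i j m → j < c → h j + r ≤ i → i < r + r →
               Σ ℕ λ u → n + n < u × u ≤ n + n + x × m ≡ just u
    Cell-new {j = j} (old i<h _) j<c le i<R = contradiction (≤-trans (m≤m+n (h j) r) le) (<⇒≱ i<h)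
    Cell-new {j = j} (mid k k<r _ refl _) j<c le i<R =
      contradiction (+-cancelˡ-≤ (h j) _ _ le) (<⇒≱ k<r)
    Cell-new (new u _ _ _ lo hi m≡) j<c le i<R = u , lo , hi , m≡
    Cell-new (out ¬in _) j<c le i<R = contradiction (i<R , j<c) ¬in

    Cell-out : ∀ {i j m} → Cell h cur x i j m → ¬ (i < r + r × j < c) → m ≡ nothing
    Cell-out {j = j} (old i<h _) ¬in =
      contradiction (<-≤-trans i<h (≤-trans (bounded j) (m≤m+n r r)) , in-columns i<h) ¬in
    Cell-out {j = j} (mid k k<r j<c refl _) ¬in = contradiction (+-mono-≤-< (bounded j) k<r , j<c) ¬in
    Cell-out (new _ j<c _ i<R _ _ _) ¬in = contradiction (i<R , j<c) ¬in
    Cell-out (out _ m≡) _ = m≡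

  -- The hole has stopped beneath the entries of the lower tableau in its column, where a new entry
  -- may be put.
  record Settled (h : ℕ → ℕ) (cur : Filling) (x : ℕ) (s : SlideResult) : Set where
    field
      row<   : proj₁ (proj₁ (proj₂ s)) < r + r
      col<   : proj₂ (proj₁ (proj₂ s)) < c
      beyond : h (proj₂ (proj₁ (proj₂ s))) + r ≤ proj₁ (proj₁ (proj₂ s))
      rest   : AllBut h cur x (proj₁ s) (proj₁ (proj₁ (proj₂ s))) (proj₂ (proj₁ (proj₂ s)))

  moves : SlideResult → List (ℕ × ℕ)
  moves s = proj₂ (proj₂ s)

  IsNew : ℕ → ℕ → Set
  IsNew x u = n + n < u × u ≤ n + n + x

  -- `lookupRow` returns 0 for a row into which nothing moves, and 0 is not new; so this also
  -- asserts a move into each row from `i` to the last but one.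
  NewMoves : ℕ → ℕ → List (ℕ × ℕ) → Set
  NewMoves x i ms = ∀ a → i ≤ a → suc a < r + r → IsNew x (lookupRow a ms)

  NewMoves-∷ : ∀ {x i v} ms → IsNew x v → NewMoves x (suc i) ms → NewMoves x i ((i , v) ∷ ms)
  NewMoves-∷ {x} {i} {v} ms isNew later a i≤a a<R with m≤n⇒m<n∨m≡n i≤a
  ... | inj₁ i<a  = subst (IsNew x) (sym (lookup-miss v ms i<a)) (later a i<a a<R)
  ... | inj₂ refl = subst (IsNew x) (sym (lookup-hit i v ms)) isNew

  NewMoves-skip : ∀ {x i i′ v} ms → i < i′ → NewMoves x i′ ms → NewMoves x i′ ((i , v) ∷ ms)
  NewMoves-skip {x} {v = v} ms i<i′ later a i′≤a a<R =
    subst (IsNew x) (sym (lookup-miss v ms (<-≤-trans i<i′ i′≤a))) (later a i′≤a a<R)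

  -- Columns get no longer to the right, so the cells with h j + r ≤ i are closed under steps right
  -- and down. Inside the rectangle they hold new entries, so only such entries move, whatever the
  -- comparisons, and the hole stops only in the bottom right corner.
  slide-new : ∀ {h cur x} (H : Heights h) f T i j → i < r + r → j < c → h j + r ≤ i →
    r + r + c ≤ f + (i + j) → AllBut h cur x T i j →
    Settled h cur x (slide f T i j) × NewMoves x i (moves (slide f T i j))
  slide-new H zero T i j i<R j<c _ fuel _ = contradiction fuel (out-of-fuel i<R j<c)
  slide-new {h} {cur} {x} H (suc f) T i j i<R j<c h≤i fuel but = go (suc i <? r + r) (suc j <? c)
    where
    open Heights H
    Goal : SlideResult → Set
    Goal s = Settled h cur x s × NewMoves x i (moves s)
    down : Cell h cur x (suc i) j (T (suc i) j)
    down = but (suc i) j λ ()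
    right : Cell h cur x i (suc j) (T i (suc j))
    right = but i (suc j) λ ()
    h≤i′ : h (suc j) + r ≤ i
    h≤i′ = ≤-trans (+-monoˡ-≤ r (antitone j)) h≤i
    filled : ∀ {u} → IsNew x u → Cell h cur x i j (just u)
    filled (lo , hi) = new _ j<c h≤i i<R lo hi refl
    goRight : ∀ {u} → suc j < c → IsNew x u → T i (suc j) ≡ just u →
              (∀ v → T (suc i) j ≡ just v → u < v) → Goal (slide (suc f) T i j)
    goRight {u} j′<c isNew eq less = subst Goal (sym (slide-right f T i j eq less))
      (slide-new H f _ i (suc j) i<R j′<c h≤i′ (fuel-step f i j fuel)
        (shift-all (Cell h cur x) (λ a b _ → but a b) (filled isNew)))
    goDown : ∀ {v} → suc i < r + r → IsNew x v → T (suc i) j ≡ just v →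
             (∀ u → T i (suc j) ≡ just u → v ≤ u) → Goal (slide (suc f) T i j)
    goDown {v} i′<R isNew eq less = subst Goal (sym (slide-down f T i j eq less))
      -- `Settled` does not look at the moves but is indexed by the whole result, so it is rebuilt
      -- for the longer list of moves.
      (record { Settled (proj₁ rec) } , NewMoves-∷ (moves (slide f (shift T i j (suc i) j v) (suc i) j)) isNew (proj₂ rec))
      where
      rec = slide-new H f (shift T i j (suc i) j v) (suc i) j i′<R j<c (≤-trans h≤i (n≤1+n i))
        (fuel-step′ f i j fuel)
        (shift-all (Cell h cur x) (λ a b _ → but a b) (filled isNew))
    go : _ → _ → Goal (slide (suc f) T i j)
    go (no i′≮R) (no j′≮c) = subst Goal
      (sym (slide-stop f T i j (Cell-out H right (j′≮c ∘ proj₂)) (Cell-out H down (i′≮R ∘ proj₁))))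
      (record { row< = i<R ; col< = j<c ; beyond = h≤i ; rest = but } ,
       λ a i≤a a<R → contradiction (≤-<-trans (s≤s i≤a) a<R) i′≮R)
    go (no i′≮R) (yes j′<c) with Cell-new H right j′<c h≤i′ i<R
    ... | u , lo , hi , eq = goRight j′<c (lo , hi) eq
          λ v eq′ → contradiction (trans (sym eq′) (Cell-out H down (i′≮R ∘ proj₁))) λ ()
    go (yes i′<R) (no j′≮c) with Cell-new H down j<c (≤-trans h≤i (n≤1+n i)) i′<R
    ... | v , lo , hi , eq = goDown i′<R (lo , hi) eq
          λ u eq′ → contradiction (trans (sym eq′) (Cell-out H right (j′≮c ∘ proj₂))) λ ()
    go (yes i′<R) (yes j′<c)
      with Cell-new H right j′<c h≤i′ i<R | Cell-new H down j<c (≤-trans h≤i (n≤1+n i)) i′<R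
    ... | u , lo , hi , eq | v , lo′ , hi′ , eq′ with u <? v
    ...   | yes u<v = goRight j′<c (lo , hi) eq
            λ w eq″ → subst (u <_) (just-injective (trans (sym eq′) eq″)) u<v
    ...   | no  u≮v = goDown i′<R (lo′ , hi′) eq′
            λ w eq″ → subst (v ≤_) (just-injective (trans (sym eq) eq″)) (≮⇒≥ u≮v)

  MidMoves : ℕ → ℕ → ℕ → List (ℕ × ℕ) → Set
  MidMoves a b k ms = ∀ {k′} → k ≤ k′ → k′ < r → lookupRow (a + k′) ms ≡ n + q k′ b

  -- Column b of the lower tableau moves up one step: the neighbour to the right of the hole
  -- either belongs to the lower tableau, in a row that is no higher than that of the entry
  -- below the hole, or is a new entry.
  slide-mid : ∀ {h cur x} (H : Heights h) {b} → b < c → h b < r →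
    ∀ d k f T i → k + d ≡ r → i ≡ h b + k → r + r + c ≤ f + (i + b) →
    (∀ i′ j′ → ¬ (j′ ≡ b × i ≤ i′ × i′ ≤ h b + r) → Cell h cur x i′ j′ (T i′ j′)) →
    (∀ k′ → k ≤ k′ → k′ < r → T (suc (h b + k′)) b ≡ just (n + q k′ b)) →
    Settled h cur x (slide f T i b) × MidMoves (h b) b k (moves (slide f T i b))
      × NewMoves x (h b + r) (moves (slide f T i b))
  -- `h` is the shape after the corner has left it, so the entries of column `b` that have yet to
  -- move sit one row too low: `others` leaves them out and `column` locates them. Their number is
  -- `d`; at 0 the hole has reached the first new row.
  slide-mid {h} {cur} {x} H {b} b<c a<r zero k f T i k≡ refl fuel others column
    with trans (sym (+-identityʳ k)) k≡
  ... | refl = proj₁ rec , (λ r≤k′ k′<r → contradiction k′<r (≤⇒≯ r≤k′)) , proj₂ rec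
    where
    rec = slide-new H f T (h b + k) b (+-monoˡ-< k a<r) b<c ≤-refl fuel
      λ i′ j′ ≢ → others i′ j′ λ { (refl , le , ge) → ≢ (≤-antisym ge le , refl) }
  slide-mid {h} {cur} {x} H {b} b<c a<r (suc d) k zero T i k≡ refl fuel others column =
    contradiction fuel (out-of-fuel (+-mono-<-≤ a<r (≤-trans (m≤m+n k (suc d)) (≤-reflexive k≡))) b<c)
  slide-mid {h} {cur} {x} H {b} b<c a<r (suc d) k (suc f) T i k≡ refl fuel others column =
    subst Goal (sym (slide-down f T i b below right))
      (record { Settled (proj₁ rec) } , mids , NewMoves-skip ms′ (+-monoʳ-< (h b) k<r) (proj₂ (proj₂ rec)))
    where
    open Heights H
    a = h b
    Goal : SlideResult → Set
    Goal s = Settled h cur x s × MidMoves a b k (moves s) × NewMoves x (a + r) (moves s)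
    k<r : k < r
    k<r = ≤-trans (≤-trans (s≤s (m≤m+n k d)) (≤-reflexive (sym (+-suc k d)))) (≤-reflexive k≡)
    below : T (suc (a + k)) b ≡ just (n + q k b)
    below = column k ≤-refl k<r
    right : ∀ u → T (a + k) (suc b) ≡ just u → n + q k b ≤ u
    right u eq with others (a + k) (suc b) (1+n≢n ∘ proj₁)
    ... | old i<h _ = contradiction (≤-trans (antitone b) (m≤m+n a k)) (<⇒≱ i<h)
    ... | mid k′ k′<r b′<c i≡ m≡ =
          subst (n + q k b ≤_) (just-injective (trans (sym m≡) eq)) (+-monoʳ-≤ n (<⇒≤ (q-right k≤k′ k′<r b′<c)))
          where
          -- Column b + 1 of the shape is no longer than column `b`, so the row of the hole meets
          -- the lower tableau there in row k′ ≥ k.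
          k≤k′ : k ≤ k′
          k≤k′ = +-cancelˡ-≤ (h (suc b)) k k′ (≤-trans (+-monoˡ-≤ k (antitone b)) (≤-reflexive i≡))
    ... | new v _ _ _ lo _ m≡ = subst (n + q k b ≤_) (just-injective (trans (sym m≡) eq))
          (≤-trans (+-monoʳ-≤ n (q≤n k<r b<c)) (<⇒≤ lo))
    ... | out _ m≡ = contradiction (trans (sym eq) m≡) λ ()
    T′ = shift T (a + k) b (suc (a + k)) b (n + q k b)
    others′ : ∀ i′ j′ → ¬ (j′ ≡ b × suc (a + k) ≤ i′ × i′ ≤ a + r) → Cell h cur x i′ j′ (T′ i′ j′)
    others′ i′ j′ ≢ = shift-all
      (λ i′ j′ m → ¬ (j′ ≡ b × suc (a + k) ≤ i′ × i′ ≤ a + r) → Cell h cur x i′ j′ m)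
      (λ i″ j″ _ ≢source ≢″ → others i″ j″ λ { (refl , le , ge) →
        ≢″ (refl , ≤∧≢⇒< le (λ eq → ≢source (sym eq , refl)) , ge) })
      (λ _ → mid k k<r b<c refl refl) i′ j′
      (λ { (refl , refl) → ≢ (refl , ≤-refl , +-monoʳ-< a k<r) }) ≢
    column′ : ∀ k′ → suc k ≤ k′ → k′ < r → T′ (suc (a + k′)) b ≡ just (n + q k′ b)
    column′ k′ k<k′ k′<r = trans (update-miss (update T (a + k) b (just (n + q k b))) nothing (distinct ∘ suc-injective ∘ proj₁))
      (trans (update-miss T (just (n + q k b)) (λ { (eq , _) → <-irrefl (sym eq) (s≤s (+-monoʳ-≤ a (<⇒≤ k<k′))) }))
        (column k′ (<⇒≤ k<k′) k′<r))
      where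
      distinct : a + k′ ≢ a + k
      distinct eq = <-irrefl (sym (+-cancelˡ-≡ a k′ k eq)) k<k′
    rec = slide-mid H b<c a<r d (suc k) f T′ (suc (a + k)) (trans (sym (+-suc k d)) k≡) (sym (+-suc a k))
      (fuel-step′ f (a + k) b fuel) others′ column′
    ms′ = moves (slide f T′ (suc (a + k)) b)
    mids : MidMoves a b k ((a + k , n + q k b) ∷ ms′)
    mids {k′} k≤k′ k′<r with m≤n⇒m<n∨m≡n k≤k′
    ... | inj₁ k<k′ = trans (lookup-miss _ ms′ (+-monoʳ-< a k<k′)) (proj₁ (proj₂ rec) k<k′ k′<r)
    ... | inj₂ refl = lookup-hit (a + k) _ ms′

  CurCell : (ℕ → ℕ) → ℕ → ℕ → Maybe ℕ → Set
  CurCell h i j m = (i < h j × Σ ℕ λ u → 1 ≤ u × u ≤ n × m ≡ just u) ⊎ (h j ≤ i × m ≡ nothing)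

  CurBut : (ℕ → ℕ) → Filling → ℕ → ℕ → Set
  CurBut h cur a b = ∀ i j → ¬ (i ≡ a × j ≡ b) → CurCell h i j (cur i j)

  OldMoves : ℕ → ℕ → List (ℕ × ℕ) → Set
  OldMoves i a ms = ∀ {i′} → i ≤ i′ → i′ < a → 1 ≤ lookupRow i′ ms × lookupRow i′ ms ≤ n

  -- Relates a slide in the rest of the upper tableau, ending with filling `cur′` and hole (a , b),
  -- to the slide in the large one. From row `i` on, the latter moves entries at most n into the
  -- rows above `a`, column `b` of the lower tableau into the next `r` rows, and new entries into
  -- the rows after these.
  record Exit (h : ℕ → ℕ) (x i a b : ℕ) (cur′ : Filling) (s : SlideResult) : Set where
    field
      i≤a       : i ≤ a
      b<c       : b < c
      corner    : suc a ≡ h b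
      corner′   : h (suc b) ≤ a
      cur-rest  : CurBut h cur′ a b
      cur-hole  : cur′ a b ≡ nothing
      settled   : Settled (lower h b) cur′ x s
      old-moves : OldMoves i a (moves s)
      mid-moves : MidMoves a b 0 (moves s)
      new-moves : NewMoves x (a + r) (moves s)

  Exit-down : ∀ {h x i a b cur′ s v} → 1 ≤ v → v ≤ n → Exit h x (suc i) a b cur′ s →
              Exit h x i a b cur′ (addMove (i , v) s)
  Exit-down {h} {x} {i} {a} {b} {cur′} {s} {v} 1≤v v≤n E = record
    { Exit E hiding (i≤a; settled; old-moves; mid-moves; new-moves)
    ; i≤a = <⇒≤ E.i≤a
    ; settled = record { Settled E.settled }
    ; old-moves = olds
    ; mid-moves = λ _ k<r → trans (lookup-miss v (moves s) (≤-trans E.i≤a (m≤m+n a _))) (E.mid-moves z≤n k<r)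
    ; new-moves = NewMoves-skip (moves s) (≤-trans E.i≤a (m≤m+n a r)) E.new-moves }
    where
    module E = Exit E
    olds : OldMoves i a ((i , v) ∷ moves s)
    olds {i′} i≤i′ i′<a with m≤n⇒m<n∨m≡n i≤i′
    ... | inj₁ i<i′ rewrite lookup-miss v (moves s) i<i′ = E.old-moves i<i′ i′<a
    ... | inj₂ refl rewrite lookup-hit i v (moves s)     = 1≤v , v≤n

  Exits : (h : ℕ → ℕ) (x i : ℕ) → SlideResult → SlideResult → Set
  Exits h x i s′ s = Exit h x i (proj₁ (proj₁ (proj₂ s′))) (proj₂ (proj₁ (proj₂ s′))) (proj₁ s′) s

  Cell-cur : ∀ {h cur cur′ x i j m} → cur i j ≡ cur′ i j → Cell h cur x i j m → Cell h cur′ x i j m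
  Cell-cur eq (old i<h m≡)             = old i<h (trans m≡ eq)
  Cell-cur eq (mid k k<r j<c i≡ m≡)    = mid k k<r j<c i≡ m≡
  Cell-cur eq (new u j<c le lt lo hi m≡) = new u j<c le lt lo hi m≡
  Cell-cur eq (out ¬in m≡)             = out ¬in m≡

  Cell-heights : ∀ {h h′ cur x i j m} → h j ≡ h′ j → Cell h cur x i j m → Cell h′ cur x i j m
  Cell-heights eq (old i<h m≡)             = old (subst (_ <_) eq i<h) m≡
  Cell-heights eq (mid k k<r j<c i≡ m≡)    = mid k k<r j<c (trans i≡ (cong (_+ k) eq)) m≡
  Cell-heights eq (new u j<c le lt lo hi m≡) =
    new u j<c (subst (λ e → e + r ≤ _) eq le) lt lo hi m≡
  Cell-heights eq (out ¬in m≡)             = out ¬in m≡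

  lower-heights : ∀ {h a b} → Heights h → suc a ≡ h b → h (suc b) ≤ a → Heights (lower h b)
  lower-heights {h} {a} {b} H eq le = record { antitone = anti ; bounded = bound ; outside = outs }
    where
    open Heights H
    anti : ∀ j → lower h b (suc j) ≤ lower h b j
    anti j with j ≟ b | suc j ≟ b
    ... | yes refl | yes ()
    ... | yes refl | no ≢ rewrite lower-hit h eq | lower-miss h ≢ = le
    ... | no ≢ | yes refl rewrite lower-hit h eq | lower-miss h ≢ =
          ≤-trans (n≤1+n a) (≤-trans (≤-reflexive eq) (antitone j))
    ... | no ≢ | no ≢′ rewrite lower-miss h ≢ | lower-miss h ≢′ = antitone j
    bound : ∀ j → lower h b j ≤ r
    bound j with j ≟ b
    ... | yes refl rewrite lower-hit h eq = ≤-trans (n≤1+n a) (≤-trans (≤-reflexive eq) (bounded b))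
    ... | no ≢ rewrite lower-miss h ≢ = bounded j
    outs : ∀ {j} → c ≤ j → lower h b j ≡ 0
    outs {j} c≤j with j ≟ b
    ... | yes refl = contradiction (trans eq (outside c≤j)) λ ()
    ... | no ≢ rewrite lower-miss h ≢ = outside c≤j

  -- The entry n + q k j is at least n + 1, so the slide in the large tableau makes the same
  -- choices as the one in `cur` for as long as the latter moves.
  slide-old : ∀ {h x} (H : Heights h) f g T cur i j → i < h j →
    r + r + c ≤ f + (i + j) → r + c ≤ g + (i + j) →
    AllBut h cur x T i j → CurBut h cur i j → cur i j ≡ nothing →
    Exits h x i (slide g cur i j) (slide f T i j)
  slide-old H f zero T cur i j i<h _ fuel _ _ _ =
    contradiction fuel (out-of-fuel (<-≤-trans i<h (Heights.bounded H j)) (Heights.in-columns H i<h))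
  slide-old H zero (suc g) T cur i j i<h fuel _ _ _ _ =
    contradiction fuel (out-of-fuel (<-≤-trans i<h (≤-trans (Heights.bounded H j) (m≤m+n r r)))
      (Heights.in-columns H i<h))
  slide-old {h} {x} H (suc f) (suc g) T cur i j i<h fuel fuel′ but curBut hole =
    go (neighbour i (suc j) λ ()) (neighbour (suc i) j λ ())
    where
    open Heights H
    data Neighbour (i′ j′ : ℕ) : Set where
      inside  : ∀ u → i′ < h j′ → 1 ≤ u → u ≤ n → cur i′ j′ ≡ just u → T i′ j′ ≡ just u → Neighbour i′ j′
      outside′ : h j′ ≤ i′ → cur i′ j′ ≡ nothing → (∀ v → T i′ j′ ≡ just v → n < v) → Neighbour i′ j′
    large : ∀ {i′ j′ m v} → h j′ ≤ i′ → Cell h cur x i′ j′ m → m ≡ just v → n < v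
    large h≤i (old i<h _) _ = contradiction h≤i (<⇒≱ i<h)
    large _ (mid k k<r j<c _ refl) refl = ≤-trans (≤-reflexive (+-comm 1 n)) (+-monoʳ-≤ n (q≥1 k<r j<c))
    large _ (new u _ _ _ lo _ refl) refl = ≤-<-trans (m≤m+n n n) lo
    large _ (out _ refl) ()
    neighbour : ∀ i′ j′ → ¬ (i′ ≡ i × j′ ≡ j) → Neighbour i′ j′
    neighbour i′ j′ ≢ with curBut i′ j′ ≢
    ... | inj₂ (h≤i , cur≡) = outside′ h≤i cur≡ λ v → large h≤i (but i′ j′ ≢)
    ... | inj₁ (i<h , u , 1≤u , u≤n , cur≡) with but i′ j′ ≢
    ...   | old _ T≡ = inside u i<h 1≤u u≤n cur≡ (trans T≡ cur≡)
    ...   | mid k _ _ refl _ = contradiction (m≤m+n (h j′) k) (<⇒≱ i<h)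
    ...   | new _ _ le _ _ _ _ = contradiction (≤-trans (m≤m+n (h j′) r) le) (<⇒≱ i<h)
    ...   | out ¬in _ = contradiction (<-≤-trans i<h (≤-trans (bounded j′) (m≤m+n r r)) , in-columns i<h) ¬in
    Goal : SlideResult → SlideResult → Set
    Goal = Exits h x i
    but′ : ∀ {i′ j′ u} → ¬ (i ≡ i′ × j ≡ j′) → AllBut h (shift cur i j i′ j′ u) x (shift T i j i′ j′ u) i′ j′
    but′ {i′} {j′} {u} ≢ = shift-all (Cell h (shift cur i j i′ j′ u) x)
      (λ a b ≢′ ≢″ → Cell-cur (sym (trans (update-miss (update cur i j (just u)) nothing ≢′)
                                          (update-miss cur (just u) ≢″))) (but a b ≢″))
      (old i<h (sym (trans (update-miss (update cur i j (just u)) nothing ≢) (update-hit cur i j (just u)))))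
    curBut′ : ∀ {i′ j′ u} → 1 ≤ u → u ≤ n → CurBut h (shift cur i j i′ j′ u) i′ j′
    curBut′ 1≤u u≤n = shift-all (CurCell h) (λ a b _ → curBut a b) (inj₁ (i<h , _ , 1≤u , u≤n , refl))
    goRight : ∀ u → i < h (suc j) → 1 ≤ u → u ≤ n → cur i (suc j) ≡ just u → T i (suc j) ≡ just u →
      (∀ v → cur (suc i) j ≡ just v → u < v) → (∀ v → T (suc i) j ≡ just v → u < v) →
      Goal (slide (suc g) cur i j) (slide (suc f) T i j)
    goRight u i<h′ 1≤u u≤n cur≡ T≡ cur< T< =
      subst₂ Goal (sym (slide-right g cur i j cur≡ cur<)) (sym (slide-right f T i j T≡ T<))
        (slide-old H f g _ _ i (suc j) i<h′ (fuel-step f i j fuel) (fuel-step g i j fuel′)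
          (but′ (1+n≢n ∘ sym ∘ proj₂)) (curBut′ 1≤u u≤n)
          (update-hit (update cur i j (just u)) i (suc j) nothing))
    goDown : ∀ v → suc i < h j → 1 ≤ v → v ≤ n → cur (suc i) j ≡ just v → T (suc i) j ≡ just v →
      (∀ u → cur i (suc j) ≡ just u → v ≤ u) → (∀ u → T i (suc j) ≡ just u → v ≤ u) →
      Goal (slide (suc g) cur i j) (slide (suc f) T i j)
    goDown v i<h′ 1≤v v≤n cur≡ T≡ cur≤ T≤ =
      subst₂ Goal (sym (slide-down g cur i j cur≡ cur≤)) (sym (slide-down f T i j T≡ T≤))
        (Exit-down 1≤v v≤n
          (slide-old H f g _ _ (suc i) j i<h′ (fuel-step′ f i j fuel) (fuel-step′ g i j fuel′)
            (but′ (1+n≢n ∘ sym ∘ proj₁)) (curBut′ 1≤v v≤n)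
            (update-hit (update cur i j (just v)) (suc i) j nothing)))
    -- The small slide stops when both neighbours lie outside the shape, so (i , j) is a corner. The
    -- large slide goes on: relative to the lowered shape, the hole is at the place of the top entry
    -- of column `j` of the lower tableau.
    stop : h (suc j) ≤ i → h j ≤ suc i → cur i (suc j) ≡ nothing → cur (suc i) j ≡ nothing →
           Goal (slide (suc g) cur i j) (slide (suc f) T i j)
    stop right down cur-right cur-down =
      subst (λ s′ → Goal s′ (slide (suc f) T i j)) (sym (slide-stop g cur i j cur-right cur-down)) (record
        { i≤a = ≤-refl
        ; b<c = in-columns i<h
        ; corner = corner
        ; corner′ = right
        ; cur-rest = curBut
        ; cur-hole = hole
        ; settled = proj₁ below
        ; old-moves = λ i≤i′ i′<i → contradiction i≤i′ (<⇒≱ i′<i)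
        ; mid-moves = subst (λ a → MidMoves a j 0 (moves (slide (suc f) T i j))) h′j≡i (proj₁ (proj₂ below))
        ; new-moves = subst (λ a → NewMoves x (a + r) (moves (slide (suc f) T i j))) h′j≡i (proj₂ (proj₂ below)) })
      where
      corner : suc i ≡ h j
      corner = ≤-antisym i<h down
      h′ = lower h j
      h′j≡i : h′ j ≡ i
      h′j≡i = lower-hit h corner
      -- The hole and the entries of the lower tableau in column `j`, whose places move up by one,
      -- fill rows i to i + r. All other cells of the column keep their kind.
      convert : ∀ {i′} m → ¬ (i ≤ i′ × i′ ≤ i + r) → Cell h cur x i′ j m → Cell h′ cur x i′ j m
      convert m ¬between (old i′<h m≡) = old (subst (_ <_) (sym h′j≡i) (≰⇒> λ i≤i′ →
        ¬between (i≤i′ , ≤-trans (≤-pred (subst (_ <_) (sym corner) i′<h)) (m≤m+n i r)))) m≡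
      convert m ¬between (mid k k<r _ refl _) = contradiction
        ( ≤-trans (<⇒≤ i<h) (m≤m+n (h j) k)
        , ≤-trans (≤-reflexive (trans (cong (_+ k) (sym corner)) (sym (+-suc i k)))) (+-monoʳ-≤ i k<r))
        ¬between
      convert m ¬between (new u j<c le lt lo hi m≡) =
        new u j<c (≤-trans (+-monoˡ-≤ r (≤-trans (≤-reflexive h′j≡i) (<⇒≤ i<h))) le) lt lo hi m≡
      convert m ¬between (out ¬in m≡) = out ¬in m≡
      others : ∀ i′ j′ → ¬ (j′ ≡ j × i ≤ i′ × i′ ≤ h′ j + r) → Cell h′ cur x i′ j′ (T i′ j′)
      others i′ j′ ¬between with j′ ≟ j
      ... | yes refl = convert _ (λ { (p , p′) → ¬between (refl , p , subst (λ a → i′ ≤ a + r) (sym h′j≡i) p′) })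
              (but i′ j λ { (refl , _) →
                ¬between (refl , ≤-refl , subst (λ a → i ≤ a + r) (sym h′j≡i) (m≤m+n i r)) })
      ... | no ≢ = Cell-heights (sym (lower-miss h ≢)) (but i′ j′ (≢ ∘ proj₂))
      column : ∀ k′ → 0 ≤ k′ → k′ < r → T (suc (h′ j + k′)) j ≡ just (n + q k′ j)
      column k′ _ k′<r rewrite h′j≡i = Cell-mid H
        (but (suc (i + k′)) j λ { (eq , _) → <-irrefl (sym eq) (s≤s (m≤m+n i k′)) })
        k′<r (in-columns i<h) (cong (_+ k′) corner)
      below = slide-mid {cur = cur} {x} (lower-heights H corner right) (in-columns i<h)
        (subst (_< r) (sym h′j≡i) (≤-trans i<h (bounded j))) r 0 (suc f) T i refl
        (trans (sym h′j≡i) (sym (+-identityʳ (h′ j)))) fuel others column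
    go : Neighbour i (suc j) → Neighbour (suc i) j → Goal (slide (suc g) cur i j) (slide (suc f) T i j)
    go (inside u lt 1≤u u≤n cur≡ T≡) (outside′ _ cur≡′ big) = goRight u lt 1≤u u≤n cur≡ T≡
      (λ v eq → contradiction (trans (sym eq) cur≡′) λ ()) (λ v eq → ≤-<-trans u≤n (big v eq))
    go (outside′ _ cur≡′ big) (inside v lt 1≤v v≤n cur≡ T≡) = goDown v lt 1≤v v≤n cur≡ T≡
      (λ u eq → contradiction (trans (sym eq) cur≡′) λ ()) (λ u eq → ≤-trans v≤n (<⇒≤ (big u eq)))
    go (outside′ le cur≡ _) (outside′ le′ cur≡′ _) = stop le le′ cur≡ cur≡′
    go (inside u lt 1≤u u≤n cur≡ T≡) (inside v lt′ 1≤v v≤n cur≡′ T≡′) with u <? v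
    ... | yes u<v = goRight u lt 1≤u u≤n cur≡ T≡
            (λ w eq → subst (u <_) (just-injective (trans (sym cur≡′) eq)) u<v)
            (λ w eq → subst (u <_) (just-injective (trans (sym T≡′) eq)) u<v)
    ... | no u≮v = goDown v lt′ 1≤v v≤n cur≡′ T≡′
            (λ w eq → subst (v ≤_) (just-injective (trans (sym cur≡) eq)) (≮⇒≥ u≮v))
            (λ w eq → subst (v ≤_) (just-injective (trans (sym T≡) eq)) (≮⇒≥ u≮v))

-- Iterated gromotion and evacuation

-- The number of cells of the shape, which is the number of evacuation steps still to come.
total : ℕ → (ℕ → ℕ) → ℕ
total zero    h = 0
total (suc c) h = h c + total c h

total-cong : ∀ c {h h′} → (∀ {j} → j < c → h j ≡ h′ j) → total c h ≡ total c h′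
total-cong zero    eq = refl
total-cong (suc c) eq = cong₂ _+_ (eq (n<1+n c)) (total-cong c λ j<c → eq (<-trans j<c (n<1+n c)))

total-const : ∀ c r → total c (λ _ → r) ≡ c * r
total-const zero    r = refl
total-const (suc c) r = cong (λ v → r + v) (total-const c r)

total-zero : ∀ c {h} → total c h ≡ 0 → ∀ {j} → j < c → h j ≡ 0
total-zero (suc c) {h} eq {j} j<1+c with m<1+n⇒m<n∨m≡n j<1+c
... | inj₁ j<c  = total-zero c (m+n≡0⇒n≡0 (h c) eq) j<c
... | inj₂ refl = m+n≡0⇒m≡0 (h j) eq

total-lower : ∀ c h {a b} → b < c → suc a ≡ h b → total c h ≡ suc (total c (lower h b))
total-lower (suc c) h {a} {b} b<1+c eq with m<1+n⇒m<n∨m≡n b<1+c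
... | inj₂ refl = cong₂ _+_ (trans (sym eq) (cong suc (sym (lower-hit h eq))))
                    (total-cong c λ j<c → sym (lower-miss h (<⇒≢ j<c)))
... | inj₁ b<c  = trans (cong₂ _+_ (sym (lower-miss h (>⇒≢ b<c))) (total-lower c h b<c eq))
                    (+-suc (lower h b c) (total c (lower h b)))

antitone-≤ : ∀ {h : ℕ → ℕ} → (∀ j → h (suc j) ≤ h j) → ∀ j → h j ≤ h 0
antitone-≤ anti zero    = ≤-refl
antitone-≤ anti (suc j) = ≤-trans (anti j) (antitone-≤ anti j)

-- Some column is nonempty and the first is the longest, so cell (0 , 0), where the slide starts, is
-- still in the shape.
total-positive : ∀ c {h s} → (∀ j → h (suc j) ≤ h j) → total c h ≡ suc s → 0 < h 0
total-positive (suc c) {h} anti eq with h c in hc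
... | zero  = total-positive c anti eq
... | suc _ = <-≤-trans (s≤s z≤n) (≤-trans (≤-reflexive (sym hc)) (antitone-≤ anti c))

maxEntry-lub : ∀ R c T {B} → (∀ i j {v} → T i j ≡ just v → v ≤ B) → maxEntry R c T ≤ B
maxEntry-lub R c T {B} bound = go (cells R c)
  where
  value : ∀ i j → fromMaybe 0 (T i j) ≤ B
  value i j with T i j in eq
  ... | just v  = bound i j eq
  ... | nothing = z≤n
  go : ∀ L → foldr (λ ij m → fromMaybe 0 (T (proj₁ ij) (proj₂ ij)) ⊔ m) 0 L ≤ B
  go []            = z≤n
  go ((i , j) ∷ L) = ⊔-lub (value i j) (go L)

maxEntry-ub : ∀ T {R c i j v} → i < R → j < c → T i j ≡ just v → v ≤ maxEntry R c T
maxEntry-ub T {R} {c} {i} {j} {v} i<R j<c eq = go (cells R c) (cell∈ i<R j<c)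
  where
  go : ∀ L → (i , j) ∈ L → v ≤ foldr (λ ij m → fromMaybe 0 (T (proj₁ ij) (proj₂ ij)) ⊔ m) 0 L
  go (_ ∷ L) (here refl) = ≤-trans (≤-reflexive (cong (fromMaybe 0) (sym eq))) (m≤m⊔n _ _)
  go (_ ∷ L) (there ij∈) = ≤-trans (go L ij∈) (m≤n⊔m _ _)

-- The cells removed so far in the computation of the evacuation, carrying the entries above k.
record Partial (r c n : ℕ) (h : ℕ → ℕ) (k : ℕ) (T : Filling) : Set where
  field
    filled     : ∀ {i j} → h j ≤ i → i < r → j < c → Σ ℕ λ v → T i j ≡ just v
    removed    : ∀ {i j v} → T i j ≡ just v → h j ≤ i × i < r × j < c
    range      : ∀ {i j v} → T i j ≡ just v → k < v × v ≤ n
    injective  : ∀ {i j i′ j′ v} → T i j ≡ just v → T i′ j′ ≡ just v → i ≡ i′ × j ≡ j′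
    surjective : ∀ {v} → k < v → v ≤ n → Σ ℕ λ i → Σ ℕ λ j → T i j ≡ just v
    rowInc     : ∀ {i j u v} → T i j ≡ just u → T i (suc j) ≡ just v → u < v
    colInc     : ∀ {i j u v} → T i j ≡ just u → T (suc i) j ≡ just v → u < v

read-update : ∀ T {a b w} i j {v} → update T a b (just w) i j ≡ just v →
              (i ≡ a × j ≡ b × w ≡ v) ⊎ T i j ≡ just v
read-update T {a} {b} {w} i j eq with i ≟ a ×-dec j ≟ b
... | yes (refl , refl) = inj₁ (refl , refl , just-injective (trans (sym (update-hit T i j (just w))) eq))
... | no ≢              = inj₂ (trans (sym (update-miss T (just w) ≢)) eq)

Partial-empty : ∀ {r c n h} → (∀ {j} → j < c → r ≤ h j) → Partial r c n h n emptyFilling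
Partial-empty r≤h = record
  { filled     = λ h≤i i<r j<c → contradiction (≤-trans (r≤h j<c) h≤i) (<⇒≱ i<r)
  ; removed    = λ ()
  ; range      = λ ()
  ; injective  = λ ()
  ; surjective = λ n<v v≤n → contradiction v≤n (<⇒≱ n<v)
  ; rowInc     = λ ()
  ; colInc     = λ () }

-- The added label is smaller than those placed before, and its cell is a corner of the remaining
-- shape: the cells to the left and above are unlabelled, and any labels to the right and below are
-- larger.
Partial-extend : ∀ {r c n h k a b T} → a < r → b < c → suc k ≤ n → (∀ j → h (suc j) ≤ h j) → suc a ≡ h b →
                 Partial r c n h (suc k) T → Partial r c n (lower h b) k (update T a b (just (suc k)))
Partial-extend {r} {c} {n} {h} {k} {a} {b} {T} a<r b<c k<n anti corner p = record
  { filled = filled′ ; removed = removed′ ; range = range′ ; injective = injective′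
  ; surjective = surjective′ ; rowInc = rowInc′ ; colInc = colInc′ }
  where
  open Partial p
  T′ = update T a b (just (suc k))
  read : ∀ i j {v} → T′ i j ≡ just v → (i ≡ a × j ≡ b × suc k ≡ v) ⊎ T i j ≡ just v
  read = read-update T
  keep : ∀ {i j v} → T i j ≡ just v → T′ i j ≡ just v
  keep eq = trans (update-miss T _ λ { (refl , refl) →
    contradiction (proj₁ (removed eq)) (<⇒≱ (≤-reflexive corner)) }) eq
  filled′ : ∀ {i j} → lower h b j ≤ i → i < r → j < c → Σ ℕ λ v → T′ i j ≡ just v
  filled′ {i} {j} le i<r j<c with i ≟ a ×-dec j ≟ b
  ... | yes (refl , refl) = _ , update-hit T i j _
  ... | no ≢ with filled {i} {j} h≤i i<r j<c
    where
    h≤i : h j ≤ i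
    h≤i with j ≟ b
    ... | no j≢b   = ≤-trans (≤-reflexive (sym (lower-miss h j≢b))) le
    ... | yes refl = ≤-trans (≤-reflexive (sym corner))
          (≤∧≢⇒< (≤-trans (≤-reflexive (sym (lower-hit h corner))) le) λ { refl → ≢ (refl , refl) })
  ... | v , eq = v , keep eq
  lower≤ : ∀ j → lower h b j ≤ h j
  lower≤ j with j ≟ b
  ... | yes refl = ≤-trans (≤-reflexive (lower-hit h corner)) (≤-trans (n≤1+n a) (≤-reflexive corner))
  ... | no ≢     = ≤-reflexive (lower-miss h ≢)
  removed′ : ∀ {i j v} → T′ i j ≡ just v → lower h b j ≤ i × i < r × j < c
  removed′ {i} {j} eq with read i j eq
  ... | inj₁ (refl , refl , _) = ≤-reflexive (lower-hit h corner) , a<r , b<c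
  ... | inj₂ eq′ with removed eq′
  ...   | h≤i , i<r , j<c = ≤-trans (lower≤ j) h≤i , i<r , j<c
  range′ : ∀ {i j v} → T′ i j ≡ just v → k < v × v ≤ n
  range′ {i} {j} eq with read i j eq
  ... | inj₁ (_ , _ , refl) = n<1+n k , k<n
  ... | inj₂ eq′ = <-trans (n<1+n k) (proj₁ (range eq′)) , proj₂ (range eq′)
  injective′ : ∀ {i j i′ j′ v} → T′ i j ≡ just v → T′ i′ j′ ≡ just v → i ≡ i′ × j ≡ j′
  injective′ {i} {j} {i′} {j′} eq eq′ with read i j eq | read i′ j′ eq′
  ... | inj₁ (refl , refl , _) | inj₁ (refl , refl , _) = refl , refl
  ... | inj₁ (_ , _ , refl) | inj₂ e = contradiction (proj₁ (range e)) (<-irrefl refl)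
  ... | inj₂ e | inj₁ (_ , _ , refl) = contradiction (proj₁ (range e)) (<-irrefl refl)
  ... | inj₂ e | inj₂ e′ = injective e e′
  surjective′ : ∀ {v} → k < v → v ≤ n → Σ ℕ λ i → Σ ℕ λ j → T′ i j ≡ just v
  surjective′ k<v v≤n with m≤n⇒m<n∨m≡n k<v
  ... | inj₂ refl = a , b , update-hit T a b _
  ... | inj₁ lt with surjective lt v≤n
  ...   | i , j , eq = i , j , keep eq
  rowInc′ : ∀ {i j u v} → T′ i j ≡ just u → T′ i (suc j) ≡ just v → u < v
  rowInc′ {i} {j} eq eq′ with read i j eq | read i (suc j) eq′
  ... | inj₁ (_ , refl , _) | inj₁ (_ , () , _)
  ... | inj₁ (_ , _ , refl) | inj₂ e = proj₁ (range e)
  ... | inj₂ e | inj₁ (refl , refl , _) = contradiction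
        (≤-trans (≤-reflexive corner) (≤-trans (anti j) (proj₁ (removed e)))) (<-irrefl refl)
  ... | inj₂ e | inj₂ e′ = rowInc e e′
  colInc′ : ∀ {i j u v} → T′ i j ≡ just u → T′ (suc i) j ≡ just v → u < v
  colInc′ {i} {j} eq eq′ with read i j eq | read (suc i) j eq′
  ... | inj₁ (refl , _ , _) | inj₁ (() , _ , _)
  ... | inj₁ (_ , _ , refl) | inj₂ e = proj₁ (range e)
  ... | inj₂ e | inj₁ (refl , refl , _) = contradiction
        (≤-trans (n≤1+n _) (≤-trans (≤-reflexive corner) (proj₁ (removed e)))) (<-irrefl refl)
  ... | inj₂ e | inj₂ e′ = colInc e e′

Partial-complete : ∀ {r c h T} → total c h ≡ 0 → Partial r c (r * c) h 0 T → IsSYT r c T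
Partial-complete {r} {c} {h} {T} done p = record
  { shape      = λ i j →
      (λ eq → λ { (i<r , j<c) → contradiction
        (trans (sym eq) (proj₂ (filled (≤-trans (≤-reflexive (total-zero c done j<c)) z≤n) i<r j<c))) λ () }) ,
      empty i j
  ; range      = λ _ _ _ → range
  ; injective  = λ _ _ _ _ _ → injective
  ; surjective = λ _ → surjective
  ; rowInc     = λ _ _ _ _ → rowInc
  ; colInc     = λ _ _ _ _ → colInc }
  where
  open Partial p
  empty : ∀ i j → ¬ (i < r × j < c) → T i j ≡ nothing
  empty i j ¬in with T i j in eq
  ... | nothing = refl
  ... | just v  = contradiction (proj₂ (removed eq)) ¬in

module Iteration (r c n : ℕ) (q : ℕ → ℕ → ℕ)
  (q≥1 : ∀ {k j} → k < r → j < c → 1 ≤ q k j)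
  (q≤n : ∀ {k j} → k < r → j < c → q k j ≤ n)
  (q-right : ∀ {k k′ j} → k ≤ k′ → k′ < r → suc j < c → q k j < q k′ (suc j))
  (top : 1 ≤ n → Σ ℕ λ k → Σ ℕ λ j → k < r × j < c × q k j ≡ n) where

  open Gromotion r c n q q≥1 q≤n q-right

  record State (h : ℕ → ℕ) (cur : Filling) (x : ℕ) (T : Filling) : Set where
    field
      heights   : Heights h
      cells-T   : ∀ i j → Cell h cur x i j (T i j)
      cells-cur : ∀ i j → CurCell h i j (cur i j)

  moved : Filling → List (ℕ × ℕ)
  moved T = proj₂ (gromWithMoves (r + r) c T)

  record Moved (x : ℕ) (T : Filling) (a b : ℕ) : Set where
    field
      old-moves : OldMoves 0 a (moved T)
      mid-moves : MidMoves a b 0 (moved T)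
      new-moves : NewMoves x (a + r) (moved T)

  Cell-later : ∀ {h cur x i j m} → Cell h cur x i j m → Cell h cur (suc x) i j m
  Cell-later (old i<h m≡)               = old i<h m≡
  Cell-later (mid k k<r j<c i≡ m≡)      = mid k k<r j<c i≡ m≡
  Cell-later {x = x} (new u j<c le lt lo hi m≡) =
    new u j<c le lt lo (≤-trans hi (+-monoʳ-≤ (n + n) (n≤1+n x))) m≡
  Cell-later (out ¬in m≡)               = out ¬in m≡

  entries-bounded : ∀ {h cur x T} → State h cur x T → ∀ i j {v} → T i j ≡ just v → v ≤ n + n + x
  entries-bounded {x = x} st i j {v} eq with State.cells-T st i j
  ... | new u _ _ _ _ hi m≡ = subst (_≤ n + n + x) (just-injective (trans (sym m≡) eq)) hi
  ... | out _ m≡ = contradiction (trans (sym eq) m≡) λ ()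
  ... | mid k k<r j<c _ m≡ = subst (_≤ n + n + x) (just-injective (trans (sym m≡) eq))
        (≤-trans (+-monoʳ-≤ n (q≤n k<r j<c)) (m≤m+n (n + n) x))
  ... | old i<h m≡ with State.cells-cur st i j
  ...   | inj₂ (h≤i , _) = contradiction h≤i (<⇒≱ i<h)
  ...   | inj₁ (_ , u , _ , u≤n , cur≡) =
          subst (_≤ n + n + x) (just-injective (trans (sym cur≡) (trans (sym m≡) eq)))
            (≤-trans u≤n (≤-trans (m≤m+n n n) (m≤m+n (n + n) x)))

  -- The lower tableau stays whole, so its largest entry n + n, supplied by `top`, bounds the
  -- maximum from below. The upper bound comes from the invariant.
  maxEntry-new : ∀ {h cur x T} → 1 ≤ n → State h cur x T → IsNew (suc x) (suc (maxEntry (r + r) c T))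
  maxEntry-new {h} {cur} {x} {T} 1≤n st with top 1≤n
  ... | k , j , k<r , j<c , q≡n =
        s≤s (maxEntry-ub T (+-mono-≤-< (Heights.bounded heights j) k<r) j<c
          (trans (Cell-mid heights (cells-T (h j + k) j) k<r j<c refl) (cong (λ v → just (n + v)) q≡n))) ,
        ≤-trans (s≤s (maxEntry-lub (r + r) c T (entries-bounded st))) (≤-reflexive (sym (+-suc (n + n) x)))
    where open State st

  -- One gromotion of the large tableau runs alongside one step of the evacuation. The hole ends
  -- below the lower tableau in its column and receives a new entry, so the invariant holds for the
  -- lowered shape.
  step : ∀ {h cur x T} → State h cur x T → 0 < h 0 → 1 ≤ n →
    let s = deleteAndSlide r c cur
        a = proj₁ (proj₁ (proj₂ s))
        b = proj₂ (proj₁ (proj₂ s))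
    in b < c × suc a ≡ h b × State (lower h b) (proj₁ s) (suc x) (grom (r + r) c T) × Moved x T a b
  step {h} {cur} {x} {T} st 0<h 1≤n = b<c , corner , record
      { heights   = lower-heights heights corner corner′
      ; cells-T   = update-all (Cell (lower h b) cur′ (suc x)) (λ i j ≢ → Cell-later (rest i j ≢))
          (new _ col< beyond row< (proj₁ isNew) (proj₂ isNew) refl)
      ; cells-cur = cells-cur′ } ,
    record { old-moves = old-moves ; mid-moves = mid-moves ; new-moves = new-moves }
    where
    open State st
    curBut : CurBut h (update cur 0 0 nothing) 0 0
    curBut i j ≢ = subst (CurCell h i j) (sym (update-miss cur nothing ≢)) (cells-cur i j)
    but : AllBut h (update cur 0 0 nothing) x (update T 0 0 nothing) 0 0
    but i j ≢ = subst (Cell h (update cur 0 0 nothing) x i j) (sym (update-miss T nothing ≢))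
      (Cell-cur (sym (update-miss cur nothing ≢)) (cells-T i j))
    exit = slide-old heights (r + r + c) (r + c) (update T 0 0 nothing) (update cur 0 0 nothing) 0 0 0<h
      (m≤m+n (r + r + c) 0) (m≤m+n (r + c) 0) but curBut refl
    open Exit exit
    open Settled settled
    s = deleteAndSlide r c cur
    cur′ = proj₁ s
    a = proj₁ (proj₁ (proj₂ s))
    b = proj₂ (proj₁ (proj₂ s))
    isNew = maxEntry-new 1≤n st
    cells-cur′ : ∀ i j → CurCell (lower h b) i j (cur′ i j)
    cells-cur′ i j with j ≟ b
    ... | no ≢ rewrite lower-miss h ≢ = cur-rest i j (≢ ∘ proj₂)
    ... | yes refl with i ≟ a
    ...   | yes refl = inj₂ (≤-reflexive (lower-hit h corner) , cur-hole)
    ...   | no i≢a with cur-rest i j (i≢a ∘ proj₁)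
    ...     | inj₁ (i<h , u) = inj₁ (<-≤-trans (≤∧≢⇒< (≤-pred (≤-trans i<h (≤-reflexive (sym corner)))) i≢a)
                (≤-reflexive (sym (lower-hit h corner))) , u)
    ...     | inj₂ (h≤i , e) = inj₂ (≤-trans (≤-reflexive (lower-hit h corner))
                (≤-trans (n≤1+n a) (≤-trans (≤-reflexive corner) h≤i)) , e)

  Exits-at : ℕ → Filling → Filling → Set
  Exits-at x T F = Σ ℕ λ a → Σ ℕ λ b → F a b ≡ just (n ∸ x) × Moved x T a b

  module _ (n≡ : n ≡ r * c) (T : Filling) where

    grom^ : ℕ → Filling
    grom^ = gromIter (r + r) c T

    -- The number `s` is at once the number of steps left, the next label to be placed and the size
    -- of the remaining shape. Placed labels are kept, so what is recorded at step `x` remains true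
    -- of the final filling.
    loop : ∀ s x {h cur res} → x + s ≡ n → State h cur x (grom^ x) → total c h ≡ s → Partial r c n h s res →
      let F = evacLoop r c s s cur res
      in IsSYT r c F × (∀ {i j v} → res i j ≡ just v → F i j ≡ just v)
         × (∀ y → x ≤ y → y < n → Exits-at y (grom^ y) F)
    loop zero x {h} {res = res} x≡ st tot p =
      Partial-complete tot (subst (λ n → Partial r c n h 0 res) n≡ p) , (λ eq → eq) ,
      λ y x≤y y<n → contradiction (≤-<-trans x≤y y<n) (<-irrefl (trans (sym (+-identityʳ x)) x≡))
    loop (suc s) x {h} {cur} {res} x≡ st tot p
      with step st (total-positive c (Heights.antitone (State.heights st)) tot) 1≤n
      where
      1≤n : 1 ≤ n
      1≤n = ≤-trans (s≤s z≤n) (≤-trans (m≤n+m (suc s) x) (≤-reflexive x≡))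
    ... | b<c , corner , st′ , moved
      with loop s (suc x) (trans (sym (+-suc x s)) x≡) st′
             (suc-injective (trans (sym (total-lower c h b<c corner)) tot))
             (Partial-extend a<r b<c (≤-trans (m≤n+m (suc s) x) (≤-reflexive x≡))
               (Heights.antitone (State.heights st)) corner p)
      where
      a<r : _ < r
      a<r = ≤-trans (≤-reflexive corner) (Heights.bounded (State.heights st) _)
    ... | syt , keeps , exits = syt , keeps′ , exits′
      where
      a = proj₁ (proj₁ (proj₂ (deleteAndSlide r c cur)))
      b = proj₂ (proj₁ (proj₂ (deleteAndSlide r c cur)))
      F = evacLoop r c (suc s) (suc s) cur res
      keeps′ : ∀ {i j v} → res i j ≡ just v → F i j ≡ just v
      keeps′ {i} {j} eq = keeps (trans (update-miss res _ λ { (refl , refl) →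
        contradiction (proj₁ (Partial.removed p eq)) (<⇒≱ (≤-reflexive corner)) }) eq)
      exits′ : ∀ y → x ≤ y → y < n → Exits-at y (grom^ y) F
      exits′ y x≤y y<n with m≤n⇒m<n∨m≡n x≤y
      ... | inj₁ x<y  = exits y x<y y<n
      ... | inj₂ refl = a , b , trans (keeps (update-hit res a b _)) (cong just s≡) , moved
        where
        s≡ : suc s ≡ n ∸ x
        s≡ = trans (sym (m+n∸m≡n x (suc s))) (cong (_∸ x) x≡)

-- Promotion permutations

residue-id : ∀ {N v} → 1 ≤ v → v ≤ N → residue N v ≡ v
residue-id {suc N} {suc v} _ v≤N with m≤n⇒m<n∨m≡n v≤N
... | inj₁ v<N rewrite m<n⇒m%n≡m v<N = refl
... | inj₂ refl rewrite n%n≡0 (suc N) {{_}} = refl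

residue-shift : ∀ N v → residue N (v + N) ≡ residue N v
residue-shift zero    v = +-identityʳ v
residue-shift (suc N) v rewrite [m+n]%n≡m%n v (suc N) {{_}} = refl

-- New entries that move during the first n gromotions lie between 2n + 1 and 3n; modulo 2n they
-- become at most n and so stay out of the north-east block.
residue-beyond : ∀ {n u} → n + n < u → u ≤ n + n + n → residue (n + n) u ≤ n
residue-beyond {n} {u} lo hi = begin
  residue (n + n) u                     ≡⟨ cong (residue (n + n)) (sym (m∸n+n≡m (<⇒≤ lo))) ⟩
  residue (n + n) (u ∸ (n + n) + (n + n)) ≡⟨ residue-shift (n + n) (u ∸ (n + n)) ⟩
  residue (n + n) (u ∸ (n + n))         ≡⟨ residue-id (m<n⇒0<n∸m lo) (≤-trans w≤n (m≤m+n n n)) ⟩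
  u ∸ (n + n)                           ≤⟨ w≤n ⟩
  n                                     ∎
  where
  open ≤-Reasoning
  w≤n : u ∸ (n + n) ≤ n
  w≤n = m≤n+o⇒m∸n≤o u (n + n) hi

<ᵇ-split : ∀ {A : Set} {i r} (x y : A) → i < r → (if i <ᵇ r then x else y) ≡ x
<ᵇ-split x y i<r rewrite <ᵇ-true i<r = refl

≮ᵇ-split : ∀ {A : Set} {i r} (x y : A) → r ≤ i → (if i <ᵇ r then x else y) ≡ y
≮ᵇ-split x y r≤i rewrite <ᵇ-false r≤i = refl

module Stacked {r c P Q} (SP : IsSYT r c P) (SQ : IsSYT r c Q) where

  n = r * c
  R = r + r
  S = stack r n P Q
  q = entry Q

  ρ : ℕ → ℕ → ℕ
  ρ i = prom R c i S

  module SP = IsSYT SP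
  module SQ = IsSYT SQ
  module TP = Tableau SP
  module TQ = Tableau SQ
  module QI = Increasing TQ.increasing

  q-range : ∀ {k j} → k < r → j < c → 1 ≤ q k j × q k j ≤ n
  q-range k<r j<c = SQ.range _ _ _ (TQ.entry-just k<r j<c)

  q-right : ∀ {k k′ j} → k ≤ k′ → k′ < r → suc j < c → q k j < q k′ (suc j)
  q-right {j = j} k≤k′ k′<r j<c = ℤ.drop‿+<+ (ℤ.≤-<-trans
    (QI.along-col-⊑ k≤k′ k′<r (<-trans (n<1+n j) j<c)) (QI.row-⊏ j k′<r j<c))

  q-top : 1 ≤ n → Σ ℕ λ k → Σ ℕ λ j → k < r × j < c × q k j ≡ n
  q-top 1≤n with SQ.surjective n 1≤n ≤-refl
  ... | k , j , eq with TQ.inBox eq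
  ...   | k<r , j<c = k , j , k<r , j<c , just-injective (trans (sym (TQ.entry-just k<r j<c)) eq)

  q≥1 : ∀ {k j} → k < r → j < c → 1 ≤ q k j
  q≥1 k<r j<c = proj₁ (q-range k<r j<c)

  q≤n : ∀ {k j} → k < r → j < c → q k j ≤ n
  q≤n k<r j<c = proj₂ (q-range k<r j<c)

  open Gromotion r c n q q≥1 q≤n q-right
  open Iteration r c n q q≥1 q≤n q-right q-top

  h₀ : ℕ → ℕ
  h₀ j = if j <ᵇ c then r else 0

  initial-heights : Heights h₀
  initial-heights = record { antitone = anti ; bounded = bound ; outside = ≮ᵇ-split r 0 }
    where
    bound : ∀ j → h₀ j ≤ r
    bound j with j <ᵇ c
    ... | true  = ≤-refl
    ... | false = z≤n
    anti : ∀ j → h₀ (suc j) ≤ h₀ j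
    anti j with suc j <? c
    ... | yes j<c = ≤-trans (bound (suc j)) (≤-reflexive (sym (<ᵇ-split r 0 (<-trans (n<1+n j) j<c))))
    ... | no  j≮c = ≤-trans (≤-reflexive (≮ᵇ-split r 0 (≮⇒≥ j≮c))) z≤n

  initial-state : State h₀ P 0 S
  initial-state = record { heights = initial-heights ; cells-T = cells-S ; cells-cur = cells-P }
    where
    stack-above : ∀ {i} j → i < r → S i j ≡ P i j
    stack-above {i} j i<r = <ᵇ-split (P i j) _ i<r
    stack-below : ∀ {i} j → r ≤ i → S i j ≡ Maybe.map (λ v → n + v) (Q (i ∸ r) j)
    stack-below j r≤i = ≮ᵇ-split _ _ r≤i
    cells-S : ∀ i j → Cell h₀ P 0 i j (S i j)
    cells-S i j with i <? r | j <? c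
    ... | yes i<r | yes j<c = old (subst (i <_) (sym (<ᵇ-split r 0 j<c)) i<r) (stack-above j i<r)
    ... | yes i<r | no  j≮c = out (j≮c ∘ proj₂)
          (trans (stack-above j i<r) (proj₂ (SP.shape i j) (j≮c ∘ proj₂)))
    ... | no  i≮r | no  j≮c = out (j≮c ∘ proj₂)
          (trans (stack-below j (≮⇒≥ i≮r)) (cong (Maybe.map (λ v → n + v)) (proj₂ (SQ.shape (i ∸ r) j) (j≮c ∘ proj₂))))
    ... | no  i≮r | yes j<c with i ∸ r <? r
    ...   | yes k<r = mid (i ∸ r) k<r j<c
            (trans (sym (m+[n∸m]≡n (≮⇒≥ i≮r))) (cong (_+ (i ∸ r)) (sym (<ᵇ-split r 0 j<c))))
            (trans (stack-below j (≮⇒≥ i≮r)) (cong (Maybe.map (λ v → n + v)) (TQ.entry-just k<r j<c)))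
    ...   | no  k≮r = out (λ { (i<R , _) → k≮r (+-cancelˡ-< r _ _ (subst (_< R) (sym (m+[n∸m]≡n (≮⇒≥ i≮r))) i<R)) })
            (trans (stack-below j (≮⇒≥ i≮r)) (cong (Maybe.map (λ v → n + v)) (proj₂ (SQ.shape (i ∸ r) j) (k≮r ∘ proj₁))))
    cells-P : ∀ i j → CurCell h₀ i j (P i j)
    cells-P i j with j <? c
    ... | no j≮c = inj₂ (≤-trans (≤-reflexive (≮ᵇ-split r 0 (≮⇒≥ j≮c))) z≤n , proj₂ (SP.shape i j) (j≮c ∘ proj₂))
    ... | yes j<c with i <? r
    ...   | no i≮r = inj₂ (≤-trans (≤-reflexive (<ᵇ-split r 0 j<c)) (≮⇒≥ i≮r) , proj₂ (SP.shape i j) (i≮r ∘ proj₁))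
    ...   | yes i<r = inj₁ (subst (i <_) (sym (<ᵇ-split r 0 j<c)) i<r ,
            entry P i j , proj₁ range , proj₂ range , TP.entry-just i<r j<c)
      where range = SP.range _ _ _ (TP.entry-just i<r j<c)

  E : Filling
  E = evac r c P

  evacuated : IsSYT r c E × (∀ {i j v} → emptyFilling i j ≡ just v → E i j ≡ just v)
              × (∀ y → 0 ≤ y → y < n → Exits-at y (grom^ refl S y) E)
  evacuated = loop refl S n 0 refl initial-state
    (trans (total-cong c (<ᵇ-split r 0)) (trans (total-const c r) (*-comm c r)))
    (Partial-empty λ j<c → ≤-reflexive (sym (<ᵇ-split r 0 j<c)))

  SE : IsSYT r c E
  SE = proj₁ evacuated

  module SE = IsSYT SE
  module TE = Tableau SE

  f g : ℕ → ℕ → ℤ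
  f i j = + entry Q i j
  g i j = + entry E i j

  ρ-suc : ∀ m x → ρ (suc m) (suc x) ≡ residue (n + n) (lookupRow m (moved (gromIter R c S x)))
  ρ-suc m x = cong (λ N → residue N (lookupRow m (moved (gromIter R c S x)))) (*-distribʳ-+ c r r)

  ρ-mid : ∀ {m x a b k} → Moved x (gromIter R c S x) a b → b < c → k < r → m ≡ a + k →
          ρ (suc m) (suc x) ≡ n + q k b
  ρ-mid {m} {x} {a} {b} {k} mv b<c k<r refl = begin
    ρ (suc m) (suc x)                          ≡⟨ ρ-suc m x ⟩
    residue (n + n) (lookupRow (a + k) (moved (gromIter R c S x)))
                                               ≡⟨ cong (residue (n + n)) (Moved.mid-moves mv z≤n k<r) ⟩
    residue (n + n) (n + q k b)                ≡⟨ residue-id (≤-trans (q≥1 k<r b<c) (m≤n+m (q k b) n)) (+-monoʳ-≤ n (q≤n k<r b<c)) ⟩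
    n + q k b                                  ∎
    where open ≡-Reasoning

  -- Let (a , b) be the corner leaving at step x. Entries moving into rows before `a` are at most n,
  -- those moving into rows from a + r on reduce to at most n, and in between n + q k b moves into
  -- row a + k. Steps count from 0 and positions from 1, so the second coordinate n + 1 - (x + 1) is
  -- the label n - x of the corner.
  PNE-Diag : ∀ m → suc m < R → PNE n (ρ (suc m)) ≐ Diag r c f g m
  PNE-Diag m m<R p = to , from
    where
    to : PNE n (ρ (suc m)) p → Diag r c f g m p
    to (suc x , y , _ , x<n , 1≤y , _ , ρ≡ , refl) with proj₂ (proj₂ evacuated) x z≤n x<n
    ... | a , b , E≡ , mv with TE.inBox E≡
    ... | a<r , b<c = locate (m <? a) (m <? a + r)
      where
      u = lookupRow m (moved (gromIter R c S x))
      small : ¬ (residue (n + n) u ≤ n)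
      small le = <⇒≱ (≤-trans (≤-reflexive (+-comm 1 n)) (+-monoʳ-≤ n 1≤y))
        (≤-trans (≤-reflexive (trans (sym ρ≡) (ρ-suc m x))) le)
      locate : _ → _ → Diag r c f g m (+ y , + (suc n ∸ suc x))
      locate (yes m<a) _ with Moved.old-moves mv z≤n m<a
      ... | 1≤u , u≤n = contradiction
            (≤-trans (≤-reflexive (residue-id 1≤u (≤-trans u≤n (m≤m+n n n)))) u≤n) small
      locate (no m≮a) (no m≮a+r) with Moved.new-moves mv m (≮⇒≥ m≮a+r) m<R
      ... | lo , hi = contradiction (residue-beyond lo (≤-trans hi (+-monoʳ-≤ (n + n) (<⇒≤ x<n)))) small
      locate (no m≮a) (yes m<a+r) = b , a , m ∸ a , a<r , k<r , b<c , m≡ ,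
        cong₂ _,_ (cong +_ (+-cancelˡ-≡ n _ _ (trans (sym ρ≡) (ρ-mid mv b<c k<r (sym m≡)))))
                  (cong +_ (just-injective (trans (sym E≡) (TE.entry-just a<r b<c))))
        where
        m≡ : a + (m ∸ a) ≡ m
        m≡ = m+[n∸m]≡n (≮⇒≥ m≮a)
        k<r : m ∸ a < r
        k<r = +-cancelˡ-< a _ _ (subst (_< a + r) (sym m≡) m<a+r)
    from : Diag r c f g m p → PNE n (ρ (suc m)) p
    from (j , a , b , a<r , b<r , j<c , s , refl) with SE.range _ _ _ (TE.entry-just a<r j<c)
    -- Cell (a , j) of the evacuation is labelled at step n - E a j; since labels are distinct, the
    -- corner leaving at that step is this cell.
    ... | 1≤e , e≤n with proj₂ (proj₂ evacuated) (n ∸ entry E a j) z≤n (∸-monoʳ-< 1≤e e≤n)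
    ... | a′ , j′ , E≡ , mv
      with SE.injective _ _ _ _ (entry E a j) (TE.entry-just a<r j<c) (trans E≡ (cong just (m∸[m∸n]≡n e≤n)))
    ... | refl , refl = suc (n ∸ entry E a j) , entry Q b j , s≤s z≤n , ∸-monoʳ-< 1≤e e≤n ,
          q≥1 b<r j<c , q≤n b<r j<c , ρ-mid mv j<c b<r (sym s) ,
          cong (λ e → + entry Q b j , + e) (sym (m∸[m∸n]≡n e≤n))

  -- For r = 0 the set `X` refers to index 0, where there is no promotion permutation; then n = 0
  -- and both sides are empty.
  PNE-empty : ∀ i {m} → r ≡ 0 → PNE n (ρ i) ≐ Diag r c f g m
  PNE-empty i refl p =
    (λ { (x , _ , 1≤x , x≤0 , _) → contradiction (≤-trans 1≤x x≤0) λ () }) ,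
    λ { (_ , _ , _ , () , _) }

  PNE-Diag-pred : ∀ i → 1 ≤ i → i < R → PNE n (ρ i) ≐ Diag r c f g (i ∸ 1)
  PNE-Diag-pred (suc m) _ = PNE-Diag m

  X : PSet
  X = PNE n (ρ r)

  X-Diag : X ≐ Diag r c f g (r ∸ 1)
  X-Diag with r ≟ 0
  ... | yes r≡0 = PNE-empty r r≡0
  ... | no  r≢0 = PNE-Diag-pred r (n≢0⇒n>0 r≢0) (m<m+n r (n≢0⇒n>0 r≢0))

theorem3p1 : (r c : ℕ) (P Q : Filling) → IsSYT r c P → IsSYT r c Q →
    let n = r * c
        S = stack r n P Q
        ρ = λ i → prom (r + r) c i S
        X = PNE n (ρ r)
    in ViennotNE X (latticeWord r c (evac r c P)) (latticeWord r c Q)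
       × (∀ k → k < r →
            (PNE n (ρ (r + k)) ≐ SkeletonIter ↗ X k)
          × (PNE n (ρ (r ∸ k)) ≐ SkeletonIter ↙ X k)
          × (∀ j → 1 ≤ j →
               SkeletonLine ↗ (ShadowLine ↗ (SkeletonIter ↗ X k) j)
                 ≐ ShadowLine ↗ (SkeletonIter ↗ X (suc k)) j)
          × (∀ j → 1 ≤ j →
               SkeletonLine ↙ (ShadowLine ↙ (SkeletonIter ↙ X k) j)
                 ≐ ShadowLine ↙ (SkeletonIter ↙ X (suc k)) j))
theorem3p1 r c P Q SP SQ = Viennot.ViennotNE-Diag SE SQ X-Diag , λ k k<r →
    ≐-trans (PNE-Diag-pred (r + k) (≤-trans (≤-trans (s≤s z≤n) k<r) (m≤m+n r k)) (+-monoʳ-< r k<r))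
      (≐-sym (subst (λ m → SkeletonIter ↗ X k ≐ Diag r c f g m) (up k k<r) (NE.SkeletonIter-Diagonal k)))
  , ≐-trans (PNE-Diag-pred (r ∸ k) (m<n⇒0<n∸m k<r) (≤-<-trans (m∸n≤m r k) (m<m+n r (≤-trans (s≤s z≤n) k<r))))
      -- The row sum r - k - 1 before the rotation is k + (r - 1) after it.
      (≐-trans (Diag-reverse f g (down k k<r)) (≐-sym (SW.SkeletonIter-Diagonal k)))
  , NE.SkeletonLine-ShadowLine k
  , SW.SkeletonLine-ShadowLine k
  where
  open Stacked SP SQ
  open Reversal r c
  r≤ : r ≤ suc (r ∸ 1)
  r≤ = m≤n+m∸n r 1
  module NE = ShadowLines.Iterated TQ.increasing TE.increasing X-Diag r≤
  -- The row sum r - 1 is fixed by the rotation, so the ↙-skeleta start from the same antidiagonal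
  -- of the rotated tableaux.
  module SW = ShadowLines.Iterated (reverse-increasing TQ.increasing) (reverse-increasing TE.increasing)
                (≐-trans X-Diag (Diag-reverse f g refl)) r≤
  up : ∀ k → k < r → k + (r ∸ 1) ≡ r + k ∸ 1
  up k k<r = trans (sym (+-∸-assoc k (≤-trans (s≤s z≤n) k<r))) (cong (_∸ 1) (+-comm k r))
  down : ∀ k → k < r → (r ∸ k ∸ 1) + (k + (r ∸ 1)) ≡ (r ∸ 1) + (r ∸ 1)
  down k k<r = begin
    (r ∸ k ∸ 1) + (k + (r ∸ 1)) ≡⟨ sym (+-assoc (r ∸ k ∸ 1) k (r ∸ 1)) ⟩
    (r ∸ k ∸ 1) + k + (r ∸ 1)   ≡⟨ cong (λ m → m + k + (r ∸ 1)) swap-∸ ⟩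
    (r ∸ 1 ∸ k) + k + (r ∸ 1)   ≡⟨ cong (_+ (r ∸ 1)) (m∸n+n≡m (∸-monoˡ-≤ 1 k<r)) ⟩
    (r ∸ 1) + (r ∸ 1)           ∎
    where
    open ≡-Reasoning
    swap-∸ : r ∸ k ∸ 1 ≡ r ∸ 1 ∸ k
    swap-∸ = trans (∸-+-assoc r k 1) (trans (cong (r ∸_) (+-comm k 1)) (sym (∸-+-assoc r 1 k)))
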